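{- For infinitely many positive integers $t$, there exists an adaptive $t$-function dictatorship test that makes $t+\log_2(t+1)$ queries, has completeness $1$, and has soundness $\frac{(t+1)^{2}}{2^{t}}$.
   Context: All vectors lie in $\{0,1\}^n$ with coordinatewise addition mod $2$; $\vec 1$ is the all-ones vector; for $v\in\{0,1\}^n$, $|v|=\sum_i v_i$, and $v$ is identified with the subset $\{i: v_i=1\}\subseteq[n]$. For $f:\{0,1\}^n\to\mathbb{R}$ and $\alpha\in\{0,1\}^n$, $\widehat f(\alpha)=\mathbb{E}_{x}f(x)\chi_\alpha(x)$ with $\chi_\alpha(x)=(-1)^{\sum_i\alpha_ix_i}$ ($x$ uniform). For an integer $0\le w\le n$, the degree-$w$ influence of variable $i$ is $I_i^{\le w}(f)=\sum_{\alpha:\alpha_i=1,|\alpha|\le w}\widehat f(\alpha)^2$. The $i$-th dictator is $f(x)=(-1)^{x_i}$. Folding convention: all functions are accessed in folded form, i.e. to obtain the value at $x$ with $x_1=0$ the test queries the point $\vec 1+x$ and negates the answer; equivalently every function $f$ is assumed to satisfy $f(\vec1+x)=-f(x)$ (so $\mathbb{E}f=0$). A test $T$ is a $t$-function dictatorship test with completeness $c$ and soundness $s$ if it has oracle access to $f_1,\dots,f_t:\{0,1\}^n\to\{ -1,1\}$ and: (i) if there is $i\in[n]$ with $f_a(x)=(-1)^{x_i}$ for all $a\in[t]$, then $T$ accepts with probability at least $c$; (ii) for every $\epsilon>0$ there exist a constant $\tau>0$ and a fixed positive integer $w$ such that whenever $T$ accepts with probability at least $s+\epsilon$, there exist $a\neq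 b\in[t]$ and $i\in[n]$ with $I_i^{\le w}(f_a)\ge\tau$ and $I_i^{\le w}(f_b)\ge\tau$. The number of queries is the total number of function evaluations; "adaptive" means later query points may depend on answers to earlier queries. -}

module Defs where

open import Data.Bool using (Bool; true; false; not; _∧_; _xor_; if_then_else_)
open import Data.Nat as ℕ using (ℕ; zero; suc; _^_)
open import Data.Nat.Properties using (m^n≢0)
open import Data.Fin using (Fin)
open import Data.Vec using (Vec; []; _∷_; lookup; zipWith; foldr; map)
open import Data.List as List using (List; _++_)
open import Data.List.NonEmpty as List⁺ using (List⁺)
open import Data.Integer using (+_)
open import Data.Rational using (ℚ; 0ℚ; 1ℚ; _+_; _*_; -_; _/_)

-- A point of {0,1}^n : true = 1, false = 0.
Point : ℕ → Set
Point n = Vec Bool n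

-- A {-1,1}-valued function, encoded as Bool: true ↦ -1, false ↦ +1.
BoolFun : ℕ → Set
BoolFun n = Point n → Bool

sgn : Bool → ℚ
sgn b = if b then - 1ℚ else 1ℚ

allPoints : (n : ℕ) → List (Point n)
allPoints zero = [] List.∷ List.[]
allPoints (suc n) = List.map (false ∷_) (allPoints n) ++ List.map (true ∷_) (allPoints n)

sumℚ : List ℚ → ℚ
sumℚ = List.foldr _+_ 0ℚ

𝔼 : (n : ℕ) → (Point n → ℚ) → ℚ
𝔼 n g = sumℚ (List.map g (allPoints n)) * ((+ 1) / (2 ^ n)) {{m^n≢0 2 n}}

flipAll : ∀ {n} → Point n → Point n
flipAll = map not

weight : ∀ {n} → Point n → ℕ
weight = foldr _ (λ b k → if b then suc k else k) 0

χ : ∀ {n} → Point n → Point n → ℚ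
χ α x = sgn (foldr _ _xor_ false (zipWith _∧_ α x))

fourier : ∀ {n} → BoolFun n → Point n → ℚ
fourier {n} f α = 𝔼 n (λ x → sgn (f x) * χ α x)

lowInfluence : ∀ {n} → ℕ → Fin n → BoolFun n → ℚ
lowInfluence {n} w i f =
  sumℚ (List.map (λ α → if lookup α i ∧ (weight α ℕ.≤ᵇ w)
                          then fourier f α * fourier f α else 0ℚ)
                 (allPoints n))

Folded : ∀ {n} → BoolFun n → Set
Folded f = ∀ x → f (flipAll x) ≡ not (f x)
  where open import Relation.Binary.PropositionalEquality using (_≡_)

dictator : ∀ {n} → Fin n → BoolFun n
dictator i x = lookup x i

-- A deterministic adaptive query procedure for t functions on {0,1}^n
-- making at most q queries: each internal node queries f_a at a point and
-- branches on the answer; leaves accept (true) or reject (false).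
data DTree (t n : ℕ) : ℕ → Set where
  leaf  : ∀ {q} → Bool → DTree t n q
  query : ∀ {q} → Fin t → Point n → (Bool → DTree t n q) → DTree t n (suc q)

run : ∀ {t n q} → DTree t n q → (Fin t → BoolFun n) → Bool
run (leaf b) fs = b
run (query a x k) fs = run (k (fs a x)) fs

-- A randomized adaptive test with at most q queries: a uniformly random
-- choice among a nonempty finite list of query procedures
-- (i.e. a distribution with rational probabilities over decision trees).
Test : ℕ → ℕ → ℕ → Set
Test t n q = List⁺ (DTree t n q)

count : ∀ {t n q} → List (DTree t n q) → (Fin t → BoolFun n) → ℕ
count List.[] fs = 0
count (T List.∷ Ts) fs = if run T fs then suc (count Ts fs) else count Ts fs

acceptProb : ∀ {t n q} → Test t n q → (Fin t → BoolFun n) → ℚ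
acceptProb T fs = (+ count (List⁺.toList T) fs) / suc (List.length (List⁺.tail T))

{-# OPTIONS --safe #-}

-- Take t = 2^k − 1 and the Sylvester–Hadamard code of length t, whose 2^k words make the t bits pairwise
-- independent.  The test queries f₀ at a random y and gets a bit b; then it queries every f_a at X_a, where the
-- bits (X_a)_j over all a form a random codeword if y_j = b and are independent otherwise, and it accepts iff
-- the t answers form a codeword.  For the i-th dictator b = y_i, so the answers are the codeword used at i.
--
-- For soundness, fix b and the codeword c, which costs a factor 2·2^k ≤ (t+1)², and estimate E ∏ h_a(X_a) with
-- h_a = (1 + (−1)^(c_a + f_a))/2.  Averaging the coordinates out one by one, the error at coordinate j is a sum of
-- terms with at least three factors D_j h_a.  By pairwise independence and AM-GM, E|D₁D₂D₃| is at most
-- (‖D₁‖²‖D₂‖²/δ + δ‖D₃‖²)/2, in which the independent coordinates turn the norms into noise stabilities, whose sum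
-- over j is bounded.  If no two functions share an influential coordinate, one of the first two norms is at most δ²
-- and the total error is O(δ), while ∏ E h_a = 2^(−t) by folding.
module Submission where

open import Defs
open import Data.Bool using (Bool; true; false; not; _∧_; _∨_; _xor_; if_then_else_)
open import Data.Bool.Properties using (∨-zeroʳ; xor-same) renaming (_≟_ to _≟ᵇ_)
open import Data.Fin as Fin using (Fin; zero; suc)
import Data.Fin.Properties as Fin
open import Data.Integer as ℤ using (+_)
import Data.Integer.Properties as ℤ
open import Data.List as List using (List)
open import Data.List.NonEmpty as List⁺ using (List⁺)
import Data.List.Properties as List
open import Data.Nat as ℕ using (ℕ; zero; suc; _^_; z≤n; s≤s)
import Data.Nat.Coprimality as Coprime
import Data.Nat.Properties as ℕ
open import Data.Nat.Properties using (m^n≢0)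
open import Data.Product using (Σ; ∃; _×_; _,_)
open import Data.Rational using (ℚ; mkℚ; 0ℚ; 1ℚ; ½; _+_; _*_; _-_; -_; ∣_∣; 1/_; _≤_; _<_; _/_; toℚᵘ;
  NonNegative; Positive; NonZero; nonNegative; positive; *≤*; *<*)
open import Data.Rational.Properties
open import Data.Rational.Solver using (module +-*-Solver)
import Data.Rational.Unnormalised as ℚᵘ
import Data.Rational.Unnormalised.Properties as ℚᵘ
open import Data.Sum as Sum using (_⊎_; inj₁; inj₂; [_,_]′)
open import Data.Unit using (⊤; tt)
open import Data.Vec as Vec using (Vec; []; _∷_; lookup; replicate)
open import Data.Vec.Properties
  using (lookup-replicate; lookup-splitAt; lookup-map; lookup∘tabulate; tabulate∘lookup; tabulate-cong; ≡-dec)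
open import Function using (_∘_)
open import Relation.Binary.PropositionalEquality
open import Relation.Nullary using (¬_; Dec; yes; no; does; contradiction)
open import Relation.Nullary.Decidable using (_×-dec_; ¬?; dec-true; decidable-stable)

open import Algebra.Properties.CommutativeMonoid.Sum +-0-commutativeMonoid using (sum)
  renaming (∑-distrib-+ to sum-distrib-+)
open import Algebra.Properties.CommutativeMonoid.Sum *-1-commutativeMonoid
  using () renaming (sum to ∏; sum-cong-≗ to ∏-cong; ∑-distrib-+ to ∏-distrib-*)
open +-*-Solver using (solve; con; _:=_; _:+_; _:*_; _:-_; :-_)

-- Ordered-field arithmetic

*-nonneg : ∀ {a b} → 0ℚ ≤ a → 0ℚ ≤ b → 0ℚ ≤ a * b
*-nonneg {a} {b} 0≤a 0≤b =
  nonNegative⁻¹ (a * b) {{nonNeg*nonNeg⇒nonNeg a {{nonNegative 0≤a}} b {{nonNegative 0≤b}}}}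

+-nonneg : ∀ {a b} → 0ℚ ≤ a → 0ℚ ≤ b → 0ℚ ≤ a + b
+-nonneg {a} {b} p q = subst (_≤ a + b) (+-identityˡ 0ℚ) (+-mono-≤ p q)

*-monoˡ : ∀ {a b c} → 0ℚ ≤ c → a ≤ b → c * a ≤ c * b
*-monoˡ {c = c} 0≤c = *-monoˡ-≤-nonNeg c {{nonNegative 0≤c}}

*-mono : ∀ {a b c d} → 0ℚ ≤ a → 0ℚ ≤ d → a ≤ b → c ≤ d → a * c ≤ b * d
*-mono {a} {b} {c} {d} 0≤a 0≤d a≤b c≤d =
  ≤-trans (*-monoˡ 0≤a c≤d) (*-monoʳ-≤-nonNeg d {{nonNegative 0≤d}} a≤b)

≤-add : ∀ {a b d} → 0ℚ ≤ d → a + d ≡ b → a ≤ b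
≤-add {a} {b} {d} 0≤d eq =
  subst₂ _≤_ (+-identityʳ a) eq (+-monoʳ-≤ a 0≤d)

square-nonneg : ∀ a → 0ℚ ≤ a * a
square-nonneg a with ≤-total 0ℚ a
... | inj₁ 0≤a = *-nonneg 0≤a 0≤a
... | inj₂ a≤0 = subst (0ℚ ≤_) (solve 1 (λ a → :- a :* :- a := a :* a) refl a)
                   (*-nonneg (neg-antimono-≤ a≤0) (neg-antimono-≤ a≤0))

0≤½ : 0ℚ ≤ ½
0≤½ = nonNegative⁻¹ ½

half-sum : ∀ a → ½ * (a + a) ≡ a
half-sum = solve 1 (λ a → con ½ :* (a :+ a) := a) refl

∣sgn∣ : ∀ b → ∣ sgn b ∣ ≡ 1ℚ
∣sgn∣ true  = refl
∣sgn∣ false = refl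

∣*∣≤ : ∀ {a b c d} → ∣ a ∣ ≤ c → ∣ b ∣ ≤ d → ∣ a * b ∣ ≤ c * d
∣*∣≤ {a} {b} p q = subst (_≤ _) (sym (∣p*q∣≡∣p∣*∣q∣ a b))
  (*-mono (0≤∣p∣ a) (≤-trans (0≤∣p∣ b) q) p q)

∣+∣≤ : ∀ {a b c d} → ∣ a ∣ ≤ c → ∣ b ∣ ≤ d → ∣ a + b ∣ ≤ c + d
∣+∣≤ {a} {b} p q = ≤-trans (∣p+q∣≤∣p∣+∣q∣ a b) (+-mono-≤ p q)

p≤∣p∣ : ∀ p → p ≤ ∣ p ∣
p≤∣p∣ p with ≤-total 0ℚ p
... | inj₁ 0≤p = ≤-reflexive (sym (0≤p⇒∣p∣≡p 0≤p))
... | inj₂ p≤0 = ≤-trans p≤0 (0≤∣p∣ p)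

∣½*∣≤ : ∀ {a c} → ∣ a ∣ ≤ c → ∣ ½ * a ∣ ≤ ½ * c
∣½*∣≤ {a} p = ∣*∣≤ {½} {a} (≤-refl {½}) p

-- Expectations over the cube

Fun : ℕ → Set
Fun n = Point n → ℚ

-- The Fourier expansion split at the first coordinate: `av h` carries the characters that omit it,
-- `df h` those that contain it, with that factor removed.
av df : ∀ {n} → Fun (suc n) → Fun n
av h x = ½ * (h (false ∷ x) + h (true ∷ x))
df h x = ½ * (h (false ∷ x) - h (true ∷ x))

split : ∀ {n} (h : Fun (suc n)) b x → h (b ∷ x) ≡ av h x + sgn b * df h x
split h false x = solve 2 (λ a b → a := con ½ :* (a :+ b) :+ con 1ℚ :* (con ½ :* (a :- b))) refl
                    (h (false ∷ x)) (h (true ∷ x))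
split h true x = solve 2 (λ a b → b := con ½ :* (a :+ b) :+ con (- 1ℚ) :* (con ½ :* (a :- b))) refl
                    (h (false ∷ x)) (h (true ∷ x))

∑ : ∀ n → Fun n → ℚ
∑ n f = sumℚ (List.map f (allPoints n))

sumℚ-++ : ∀ xs ys → sumℚ (xs List.++ ys) ≡ sumℚ xs + sumℚ ys
sumℚ-++ List.[] ys = sym (+-identityˡ _)
sumℚ-++ (x List.∷ xs) ys = trans (cong (_+_ x) (sumℚ-++ xs ys)) (sym (+-assoc x _ _))

∑-suc : ∀ n f → ∑ (suc n) f ≡ ∑ n (f ∘ (false ∷_)) + ∑ n (f ∘ (true ∷_))
∑-suc n f = trans (cong sumℚ (List.map-++ f (List.map (false ∷_) (allPoints n)) _))
  (trans (sumℚ-++ (List.map f (List.map (false ∷_) (allPoints n))) _)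
    (cong₂ (λ a b → sumℚ a + sumℚ b) (sym (List.map-∘ (allPoints n))) (sym (List.map-∘ (allPoints n)))))

½^ : ℕ → ℚ
½^ n = ((+ 1) / (2 ^ n)) {{m^n≢0 2 n}}

-- `_/_` reduces to lowest terms, so both sides are compared as unnormalised fractions, where they
-- agree by computation.
/-* : ∀ i j m n .{{_ : ℕ.NonZero m}} .{{_ : ℕ.NonZero n}} .{{_ : ℕ.NonZero (m ℕ.* n)}} →
      (i ℤ.* j) / (m ℕ.* n) ≡ (i / m) * (j / n)
/-* i j m@(suc _) n@(suc _) = toℚᵘ-injective (ℚᵘ.≃-trans (toℚᵘ-fromℚᵘ (ℚᵘ.mkℚᵘ (i ℤ.* j) _))
  (ℚᵘ.≃-sym (ℚᵘ.≃-trans (toℚᵘ-homo-* (i / m) (j / n))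
    (ℚᵘ.*-cong (toℚᵘ-fromℚᵘ (ℚᵘ.mkℚᵘ i _)) (toℚᵘ-fromℚᵘ (ℚᵘ.mkℚᵘ j _))))))

½^-suc : ∀ n → ½^ (suc n) ≡ ½ * ½^ n
½^-suc n = /-* (+ 1) (+ 1) 2 (2 ^ n) {{_}} {{m^n≢0 2 n}} {{m^n≢0 2 (suc n)}}

𝔼-zero : ∀ f → 𝔼 0 f ≡ f []
𝔼-zero f = trans (*-identityʳ _) (+-identityʳ _)

𝔼-suc : ∀ n f → 𝔼 (suc n) f ≡ ½ * (𝔼 n (f ∘ (false ∷_)) + 𝔼 n (f ∘ (true ∷_)))
𝔼-suc n f = trans (cong₂ _*_ (∑-suc n f) (½^-suc n))
  (solve 3 (λ a b c → (a :+ b) :* (con ½ :* c) := con ½ :* (a :* c :+ b :* c)) refl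
    (∑ n (f ∘ (false ∷_))) (∑ n (f ∘ (true ∷_))) (½^ n))

𝔼-cong : ∀ n {f g : Fun n} → (∀ x → f x ≡ g x) → 𝔼 n f ≡ 𝔼 n g
𝔼-cong n eq = cong (λ l → sumℚ l * ½^ n) (List.map-cong eq (allPoints n))

𝔼-+ : ∀ n (f g : Fun n) → 𝔼 n (λ x → f x + g x) ≡ 𝔼 n f + 𝔼 n g
𝔼-+ zero f g = trans (𝔼-zero (λ x → f x + g x)) (sym (cong₂ _+_ (𝔼-zero f) (𝔼-zero g)))
𝔼-+ (suc n) f g = begin
  𝔼 (suc n) (λ x → f x + g x)
    ≡⟨ 𝔼-suc n (λ x → f x + g x) ⟩
  ½ * (𝔼 n (λ x → f₀ x + g₀ x) + 𝔼 n (λ x → f₁ x + g₁ x))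
    ≡⟨ cong₂ (λ a b → ½ * (a + b)) (𝔼-+ n f₀ g₀) (𝔼-+ n f₁ g₁) ⟩
  ½ * ((𝔼 n f₀ + 𝔼 n g₀) + (𝔼 n f₁ + 𝔼 n g₁))
    ≡⟨ solve 4 (λ a b c d → con ½ :* ((a :+ b) :+ (c :+ d)) := con ½ :* (a :+ c) :+ con ½ :* (b :+ d)) refl
         (𝔼 n f₀) (𝔼 n g₀) (𝔼 n f₁) (𝔼 n g₁) ⟩
  ½ * (𝔼 n f₀ + 𝔼 n f₁) + ½ * (𝔼 n g₀ + 𝔼 n g₁)
    ≡⟨ sym (cong₂ _+_ (𝔼-suc n f) (𝔼-suc n g)) ⟩
  𝔼 (suc n) f + 𝔼 (suc n) g ∎
  where
  open ≡-Reasoning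
  f₀ = f ∘ (false ∷_)
  f₁ = f ∘ (true ∷_)
  g₀ = g ∘ (false ∷_)
  g₁ = g ∘ (true ∷_)

𝔼-* : ∀ n k (f : Fun n) → 𝔼 n (λ x → k * f x) ≡ k * 𝔼 n f
𝔼-* zero k f = trans (𝔼-zero (λ x → k * f x)) (sym (cong (k *_) (𝔼-zero f)))
𝔼-* (suc n) k f = begin
  𝔼 (suc n) (λ x → k * f x)
    ≡⟨ 𝔼-suc n (λ x → k * f x) ⟩
  ½ * (𝔼 n (λ x → k * f₀ x) + 𝔼 n (λ x → k * f₁ x))
    ≡⟨ cong₂ (λ a b → ½ * (a + b)) (𝔼-* n k f₀) (𝔼-* n k f₁) ⟩
  ½ * (k * 𝔼 n f₀ + k * 𝔼 n f₁)
    ≡⟨ solve 3 (λ k a b → con ½ :* (k :* a :+ k :* b) := k :* (con ½ :* (a :+ b))) refl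
         k (𝔼 n f₀) (𝔼 n f₁) ⟩
  k * (½ * (𝔼 n f₀ + 𝔼 n f₁))
    ≡⟨ cong (k *_) (sym (𝔼-suc n f)) ⟩
  k * 𝔼 (suc n) f ∎
  where
  open ≡-Reasoning
  f₀ = f ∘ (false ∷_)
  f₁ = f ∘ (true ∷_)

𝔼-const : ∀ n k → 𝔼 n (λ _ → k) ≡ k
𝔼-const zero k = 𝔼-zero (λ _ → k)
𝔼-const (suc n) k = trans (𝔼-suc n (λ _ → k))
  (trans (cong (λ a → ½ * (a + a)) (𝔼-const n k)) (half-sum k))

𝔼-∣∣ : ∀ n {f g : Fun n} → (∀ x → ∣ f x ∣ ≤ g x) → ∣ 𝔼 n f ∣ ≤ 𝔼 n g
𝔼-∣∣ zero {f} {g} p = subst₂ (λ a b → ∣ a ∣ ≤ b) (sym (𝔼-zero f)) (sym (𝔼-zero g)) (p [])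
𝔼-∣∣ (suc n) {f} {g} p = subst₂ (λ a b → ∣ a ∣ ≤ b) (sym (𝔼-suc n f)) (sym (𝔼-suc n g))
  (∣½*∣≤ (∣+∣≤ (𝔼-∣∣ n (λ x → p (false ∷ x))) (𝔼-∣∣ n (λ x → p (true ∷ x)))))

𝔼-mono : ∀ n {f g : Fun n} → (∀ x → f x ≤ g x) → 𝔼 n f ≤ 𝔼 n g
𝔼-mono zero {f} {g} p = subst₂ _≤_ (sym (𝔼-zero f)) (sym (𝔼-zero g)) (p [])
𝔼-mono (suc n) {f} {g} p = subst₂ _≤_ (sym (𝔼-suc n f)) (sym (𝔼-suc n g))
  (*-monoˡ 0≤½ (+-mono-≤ (𝔼-mono n (λ x → p (false ∷ x))) (𝔼-mono n (λ x → p (true ∷ x)))))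

𝔼-av : ∀ n f → 𝔼 (suc n) f ≡ 𝔼 n (av f)
𝔼-av n f = trans (𝔼-suc n f) (sym (trans (𝔼-* n ½ (λ x → f (false ∷ x) + f (true ∷ x)))
  (cong (½ *_) (𝔼-+ n (f ∘ (false ∷_)) (f ∘ (true ∷_))))))

𝔼-swap : ∀ m n (f : Point m → Point n → ℚ) →
  𝔼 m (λ x → 𝔼 n (f x)) ≡ 𝔼 n (λ y → 𝔼 m (λ x → f x y))
𝔼-swap zero n f = trans (𝔼-zero (λ x → 𝔼 n (f x))) (sym (𝔼-cong n (λ y → 𝔼-zero (λ x → f x y))))
𝔼-swap (suc m) n f = begin
  𝔼 (suc m) (λ x → 𝔼 n (f x))
    ≡⟨ 𝔼-av m (λ x → 𝔼 n (f x)) ⟩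
  𝔼 m (λ x → ½ * (𝔼 n (f (false ∷ x)) + 𝔼 n (f (true ∷ x))))
    ≡⟨ 𝔼-cong m (λ x → sym (trans (𝔼-* n ½ (λ y → f (false ∷ x) y + f (true ∷ x) y))
         (cong (½ *_) (𝔼-+ n (f (false ∷ x)) (f (true ∷ x)))))) ⟩
  𝔼 m (λ x → 𝔼 n (λ y → av (λ z → f z y) x))
    ≡⟨ 𝔼-swap m n (λ x y → av (λ z → f z y) x) ⟩
  𝔼 n (λ y → 𝔼 m (av (λ z → f z y)))
    ≡⟨ 𝔼-cong n (λ y → sym (𝔼-av m (λ z → f z y))) ⟩
  𝔼 n (λ y → 𝔼 (suc m) (λ x → f x y)) ∎
  where open ≡-Reasoning

𝔼-++ : ∀ m n (f : Fun (m ℕ.+ n)) → 𝔼 (m ℕ.+ n) f ≡ 𝔼 m (λ x → 𝔼 n (λ y → f (x Vec.++ y)))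
𝔼-++ zero n f = sym (𝔼-zero (λ x → 𝔼 n (λ y → f (x Vec.++ y))))
𝔼-++ (suc m) n f = trans (𝔼-suc (m ℕ.+ n) f)
  (trans (cong₂ (λ a b → ½ * (a + b)) (𝔼-++ m n (f ∘ (false ∷_))) (𝔼-++ m n (f ∘ (true ∷_))))
    (sym (𝔼-suc m (λ x → 𝔼 n (λ y → f (x Vec.++ y))))))

-- `ϱ` is the noise rate: `Q-contract` needs its square to be at least `½`, and its powers must tend
-- to zero.
2ℚ ¼ ϱ : ℚ
2ℚ = + 2 / 1
¼ = + 1 / 4
ϱ = + 3 / 4

0≤1 : 0ℚ ≤ 1ℚ
0≤1 = nonNegative⁻¹ 1ℚ

0≤ϱ : 0ℚ ≤ ϱ
0≤ϱ = nonNegative⁻¹ ϱ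

ϱ≤1 : ϱ ≤ 1ℚ
ϱ≤1 = ≤ᵇ⇒≤ tt

-- Products over Fin t

∏-one : ∀ {t} (v : Fin t → ℚ) → (∀ a → v a ≡ 1ℚ) → ∏ v ≡ 1ℚ
∏-one {zero} v p = refl
∏-one {suc t} v p = cong₂ _*_ (p zero) (∏-one (v ∘ suc) (p ∘ suc))

∏-nonneg : ∀ {t} (v : Fin t → ℚ) → (∀ a → 0ℚ ≤ v a) → 0ℚ ≤ ∏ v
∏-nonneg {zero} v p = nonNegative⁻¹ 1ℚ
∏-nonneg {suc t} v p = *-nonneg (p zero) (∏-nonneg (v ∘ suc) (p ∘ suc))

∣∏∣≤1 : ∀ {t} (v : Fin t → ℚ) → (∀ a → ∣ v a ∣ ≤ 1ℚ) → ∣ ∏ v ∣ ≤ 1ℚ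
∣∏∣≤1 {zero} v p = ≤-refl
∣∏∣≤1 {suc t} v p = ∣*∣≤ {v zero} (p zero) (∣∏∣≤1 (v ∘ suc) (p ∘ suc))

dropˡ : ∀ {x y c} → ∣ x ∣ ≤ 1ℚ → ∣ y ∣ ≤ c → ∣ x * y ∣ ≤ c
dropˡ {x} {y} {c} p r = subst (∣ x * y ∣ ≤_) (*-identityˡ c) (∣*∣≤ {x} p r)

∣∏∣≤₁ : ∀ {t} (v : Fin t → ℚ) → (∀ a → ∣ v a ∣ ≤ 1ℚ) → ∀ a → ∣ ∏ v ∣ ≤ ∣ v a ∣
∣∏∣≤₁ {suc t} v p zero = subst (∣ ∏ v ∣ ≤_) (*-identityʳ _)
  (∣*∣≤ {v zero} ≤-refl (∣∏∣≤1 (v ∘ suc) (p ∘ suc)))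
∣∏∣≤₁ {suc t} v p (suc a) = dropˡ {v zero} (p zero) (∣∏∣≤₁ (v ∘ suc) (p ∘ suc) a)

∣∏∣≤₂ : ∀ {t} (v : Fin t → ℚ) → (∀ a → ∣ v a ∣ ≤ 1ℚ) → ∀ {a b} → a Fin.< b → ∣ ∏ v ∣ ≤ ∣ v a ∣ * ∣ v b ∣
∣∏∣≤₂ {suc t} v p {zero} {suc b} _ = ∣*∣≤ {v zero} ≤-refl (∣∏∣≤₁ (v ∘ suc) (p ∘ suc) b)
∣∏∣≤₂ {suc t} v p {suc a} {suc b} (s≤s a<b) = dropˡ {v zero} (p zero) (∣∏∣≤₂ (v ∘ suc) (p ∘ suc) a<b)

-- The remaining factors have absolute value at most `1`; the strict order encodes that the three
-- indices are distinct.
∣∏∣≤₃ : ∀ {t} (v : Fin t → ℚ) → (∀ a → ∣ v a ∣ ≤ 1ℚ) → ∀ {a b c} → a Fin.< b → b Fin.< c →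
        ∣ ∏ v ∣ ≤ ∣ v a ∣ * (∣ v b ∣ * ∣ v c ∣)
∣∏∣≤₃ {suc t} v p {zero} {suc b} {suc c} _ (s≤s b<c) = ∣*∣≤ {v zero} ≤-refl (∣∏∣≤₂ (v ∘ suc) (p ∘ suc) b<c)
∣∏∣≤₃ {suc t} v p {suc a} {suc b} {suc c} (s≤s a<b) (s≤s b<c) =
  dropˡ {v zero} (p zero) (∣∏∣≤₃ (v ∘ suc) (p ∘ suc) a<b b<c)

-- Multiplying out: `S` records which of the two terms each factor contributes, and the `½` from
-- each factor turns the sum over `S` into an expectation.
∏-av : ∀ {t} (v : Fin t → Bool → ℚ) →
  ∏ (λ a → ½ * (v a false + v a true)) ≡ 𝔼 t (λ S → ∏ (λ a → v a (lookup S a)))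
∏-av {zero} v = sym (𝔼-zero (λ S → ∏ {0} (λ a → v a (lookup S a))))
∏-av {suc t} v = begin
  ½ * (v zero false + v zero true) * ∏ (λ a → ½ * (v (suc a) false + v (suc a) true))
    ≡⟨ cong (½ * (v zero false + v zero true) *_) (∏-av (v ∘ suc)) ⟩
  ½ * (v zero false + v zero true) * 𝔼 t w
    ≡⟨ solve 3 (λ a b c → con ½ :* (a :+ b) :* c := con ½ :* (a :* c :+ b :* c)) refl
         (v zero false) (v zero true) (𝔼 t w) ⟩
  ½ * (v zero false * 𝔼 t w + v zero true * 𝔼 t w)
    ≡⟨ cong₂ (λ a b → ½ * (a + b)) (sym (𝔼-* t (v zero false) w)) (sym (𝔼-* t (v zero true) w)) ⟩
  ½ * (𝔼 t (λ S → v zero false * w S) + 𝔼 t (λ S → v zero true * w S))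
    ≡⟨ sym (𝔼-suc t (λ S → ∏ (λ a → v a (lookup S a)))) ⟩
  𝔼 (suc t) (λ S → ∏ (λ a → v a (lookup S a))) ∎
  where
  open ≡-Reasoning
  w : Fun t
  w S = ∏ (λ a → v (suc a) (lookup S a))

-- Noise stability

_↾_ : ∀ {n} → Fun (suc n) → Bool → Fun n
(h ↾ b) x = h (b ∷ x)

-- stab q n h is the noise stability Σ_α q^|α| ĥ(α)², computed one coordinate at a time.
stab : ℚ → ∀ n → Fun n → ℚ
stab q zero    h = h [] * h []
stab q (suc n) h = stab q n (av h) + q * stab q n (df h)

stab-cong : ∀ q n {f g : Fun n} → (∀ x → f x ≡ g x) → stab q n f ≡ stab q n g
stab-cong q zero p = cong₂ _*_ (p []) (p [])
stab-cong q (suc n) p = cong₂ (λ a b → a + q * b)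
  (stab-cong q n (λ x → cong₂ (λ a b → ½ * (a + b)) (p (false ∷ x)) (p (true ∷ x))))
  (stab-cong q n (λ x → cong₂ (λ a b → ½ * (a - b)) (p (false ∷ x)) (p (true ∷ x))))

stab-nonneg : ∀ {q} → 0ℚ ≤ q → ∀ n h → 0ℚ ≤ stab q n h
stab-nonneg 0≤q zero h = square-nonneg (h [])
stab-nonneg 0≤q (suc n) h = +-nonneg (stab-nonneg 0≤q n (av h)) (*-nonneg 0≤q (stab-nonneg 0≤q n (df h)))

stab-scale : ∀ q n k h → stab q n (λ x → k * h x) ≡ k * k * stab q n h
stab-scale q zero k h = solve 2 (λ k a → (k :* a) :* (k :* a) := k :* k :* (a :* a)) refl k (h [])
stab-scale q (suc n) k h = begin
  stab q n (av (λ x → k * h x)) + q * stab q n (df (λ x → k * h x))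
    ≡⟨ cong₂ (λ a b → a + q * b)
        (stab-cong q n (λ x → solve 3 (λ k a b → con ½ :* (k :* a :+ k :* b) := k :* (con ½ :* (a :+ b))) refl k (h (false ∷ x)) (h (true ∷ x))))
        (stab-cong q n (λ x → solve 3 (λ k a b → con ½ :* (k :* a :- k :* b) := k :* (con ½ :* (a :- b))) refl k (h (false ∷ x)) (h (true ∷ x)))) ⟩
  stab q n (λ x → k * av h x) + q * stab q n (λ x → k * df h x)
    ≡⟨ cong₂ (λ a b → a + q * b) (stab-scale q n k (av h)) (stab-scale q n k (df h)) ⟩
  k * k * stab q n (av h) + q * (k * k * stab q n (df h))
    ≡⟨ solve 4 (λ q k a b → k :* a :+ q :* (k :* b) := k :* (a :+ q :* b)) refl q (k * k) (stab q n (av h)) (stab q n (df h)) ⟩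
  k * k * (stab q n (av h) + q * stab q n (df h)) ∎
  where open ≡-Reasoning

-- A quadratic form that is diagonal in the Fourier basis obeys the parallelogram law.
stab-parallelogram : ∀ q n (f g : Fun n) →
  stab q n (λ x → f x + g x) + stab q n (λ x → f x - g x) ≡ 2ℚ * (stab q n f + stab q n g)
stab-parallelogram q zero f g =
  solve 2 (λ a b → (a :+ b) :* (a :+ b) :+ (a :- b) :* (a :- b) := con 2ℚ :* (a :* a :+ b :* b)) refl (f []) (g [])
stab-parallelogram q (suc n) f g = begin
  (stab q n (av (λ x → f x + g x)) + q * stab q n (df (λ x → f x + g x))) +
  (stab q n (av (λ x → f x - g x)) + q * stab q n (df (λ x → f x - g x)))
    ≡⟨ cong₂ _+_
        (cong₂ (λ a b → a + q * b)
          (stab-cong q n (λ x → solve 4 (λ a b c d → con ½ :* ((a :+ b) :+ (c :+ d)) := con ½ :* (a :+ c) :+ con ½ :* (b :+ d)) refl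
             (f (false ∷ x)) (g (false ∷ x)) (f (true ∷ x)) (g (true ∷ x))))
          (stab-cong q n (λ x → solve 4 (λ a b c d → con ½ :* ((a :+ b) :- (c :+ d)) := con ½ :* (a :- c) :+ con ½ :* (b :- d)) refl
             (f (false ∷ x)) (g (false ∷ x)) (f (true ∷ x)) (g (true ∷ x)))))
        (cong₂ (λ a b → a + q * b)
          (stab-cong q n (λ x → solve 4 (λ a b c d → con ½ :* ((a :- b) :+ (c :- d)) := con ½ :* (a :+ c) :- con ½ :* (b :+ d)) refl
             (f (false ∷ x)) (g (false ∷ x)) (f (true ∷ x)) (g (true ∷ x))))
          (stab-cong q n (λ x → solve 4 (λ a b c d → con ½ :* ((a :- b) :- (c :- d)) := con ½ :* (a :- c) :- con ½ :* (b :- d)) refl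
             (f (false ∷ x)) (g (false ∷ x)) (f (true ∷ x)) (g (true ∷ x))))) ⟩
  (stab q n (λ x → av f x + av g x) + q * stab q n (λ x → df f x + df g x)) +
  (stab q n (λ x → av f x - av g x) + q * stab q n (λ x → df f x - df g x))
    ≡⟨ solve 5 (λ q a b c d → (a :+ q :* b) :+ (c :+ q :* d) := (a :+ c) :+ q :* (b :+ d)) refl
         q (stab q n (λ x → av f x + av g x)) (stab q n (λ x → df f x + df g x))
           (stab q n (λ x → av f x - av g x)) (stab q n (λ x → df f x - df g x)) ⟩
  (stab q n (λ x → av f x + av g x) + stab q n (λ x → av f x - av g x)) +
  q * (stab q n (λ x → df f x + df g x) + stab q n (λ x → df f x - df g x))
    ≡⟨ cong₂ (λ a b → a + q * b) (stab-parallelogram q n (av f) (av g)) (stab-parallelogram q n (df f) (df g)) ⟩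
  2ℚ * (stab q n (av f) + stab q n (av g)) + q * (2ℚ * (stab q n (df f) + stab q n (df g)))
    ≡⟨ solve 5 (λ q a b c d → con 2ℚ :* (a :+ b) :+ q :* (con 2ℚ :* (c :+ d)) := con 2ℚ :* ((a :+ q :* c) :+ (b :+ q :* d))) refl
         q (stab q n (av f)) (stab q n (av g)) (stab q n (df f)) (stab q n (df g)) ⟩
  2ℚ * ((stab q n (av f) + q * stab q n (df f)) + (stab q n (av g) + q * stab q n (df g))) ∎
  where open ≡-Reasoning

-- The two restrictions are `av h + df h` and `av h - df h`, so this is the parallelogram law.
stab-halves : ∀ q n (h : Fun (suc n)) →
  stab q n (h ↾ false) + stab q n (h ↾ true) ≡ 2ℚ * (stab q n (av h) + stab q n (df h))
stab-halves q n h = trans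
  (cong₂ _+_
    (stab-cong q n (λ x → trans (split h false x) (cong (_+_ (av h x)) (*-identityˡ (df h x)))))
    (stab-cong q n (λ x → trans (split h true x) (solve 2 (λ a b → a :+ con (- 1ℚ) :* b := a :- b) refl (av h x) (df h x)))))
  (stab-parallelogram q n (av h) (df h))

-- An affine form in the sign of the restricting bit, so that averages over pairwise independent
-- bits can be taken with `𝔼-affine` and `𝔼-affine₂`.
stab-slice : ∀ q n (h : Fun (suc n)) b →
  stab q n (h ↾ b) ≡ (stab q n (av h) + stab q n (df h)) + sgn b * (½ * (stab q n (h ↾ false) - stab q n (h ↾ true)))
stab-slice q n h b = trans (lemma b)
  (cong (λ a → a + sgn b * (½ * (stab q n (h ↾ false) - stab q n (h ↾ true))))
    (trans (cong (½ *_) (stab-halves q n h))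
      (solve 1 (λ a → con ½ :* (con 2ℚ :* a) := a) refl (stab q n (av h) + stab q n (df h)))))
  where
  lemma : ∀ b → stab q n (h ↾ b) ≡ ½ * (stab q n (h ↾ false) + stab q n (h ↾ true)) +
                                sgn b * (½ * (stab q n (h ↾ false) - stab q n (h ↾ true)))
  lemma false = solve 2 (λ a b → a := con ½ :* (a :+ b) :+ con 1ℚ :* (con ½ :* (a :- b))) refl
                  (stab q n (h ↾ false)) (stab q n (h ↾ true))
  lemma true = solve 2 (λ a b → b := con ½ :* (a :+ b) :+ con (- 1ℚ) :* (con ½ :* (a :- b))) refl
                  (stab q n (h ↾ false)) (stab q n (h ↾ true))

Bounded : ∀ {n} → Fun n → Set
Bounded h = ∀ x → ∣ h x ∣ ≤ 1ℚ

av-bounded : ∀ {n} {h : Fun (suc n)} → Bounded h → Bounded (av h)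
av-bounded p x = ∣½*∣≤ (∣+∣≤ (p (false ∷ x)) (p (true ∷ x)))

df-bounded : ∀ {n} {h : Fun (suc n)} → Bounded h → Bounded (df h)
df-bounded {h = h} p x = ∣½*∣≤ (≤-trans (∣p-q∣≤∣p∣+∣q∣ (h (false ∷ x)) (h (true ∷ x)))
  (+-mono-≤ (p (false ∷ x)) (p (true ∷ x))))

∣a∣²≡a² : ∀ a → ∣ a ∣ * ∣ a ∣ ≡ a * a
∣a∣²≡a² a = trans (sym (∣p*q∣≡∣p∣*∣q∣ a a)) (0≤p⇒∣p∣≡p (square-nonneg a))

-- Raising the weight of `df h` from `q` to `1` turns the sum into the average of the stabilities of
-- the two restrictions, to which the induction applies.
stab≤1 : ∀ {q} → 0ℚ ≤ q → q ≤ 1ℚ → ∀ n h → Bounded h → stab q n h ≤ 1ℚ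
stab≤1 0≤q q≤1 zero h p = subst (_≤ 1ℚ) (∣a∣²≡a² (h [])) (*-mono (0≤∣p∣ (h [])) 0≤1 (p []) (p []))
stab≤1 {q} 0≤q q≤1 (suc n) h p = begin
  stab q n (av h) + q * stab q n (df h)
    ≤⟨ +-monoʳ-≤ (stab q n (av h)) (*-monoʳ-≤-nonNeg (stab q n (df h)) {{nonNegative (stab-nonneg 0≤q n (df h))}} q≤1) ⟩
  stab q n (av h) + 1ℚ * stab q n (df h)
    ≡⟨ solve 2 (λ a b → a :+ con 1ℚ :* b := con ½ :* (con 2ℚ :* (a :+ b))) refl (stab q n (av h)) (stab q n (df h)) ⟩
  ½ * (2ℚ * (stab q n (av h) + stab q n (df h)))
    ≡⟨ cong (½ *_) (sym (stab-halves q n h)) ⟩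
  ½ * (stab q n (h ↾ false) + stab q n (h ↾ true))
    ≤⟨ *-monoˡ 0≤½ (+-mono-≤ (stab≤1 0≤q q≤1 n (h ↾ false) (λ x → p (false ∷ x)))
                               (stab≤1 0≤q q≤1 n (h ↾ true) (λ x → p (true ∷ x)))) ⟩
  1ℚ ∎
  where open ≤-Reasoning

-- Subsets with at most two elements

mask : ∀ {t} → Vec Bool t → (Fin t → ℚ) → Fin t → ℚ
mask S v a = if lookup S a then v a else 1ℚ

-- Sets of one or two elements come with the exact product, whose mean then vanishes; `three` means
-- at least three elements, of which it names three.
data Size {t} (S : Vec Bool t) : Set where
  none  : S ≡ replicate t false → Size S
  one   : ∀ a → (∀ v → ∏ (mask S v) ≡ v a) → lookup S a ≡ true → Size S
  two   : ∀ {a b} → a Fin.< b → (∀ v → ∏ (mask S v) ≡ v a * v b) →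
          lookup S a ≡ true → lookup S b ≡ true → Size S
  three : ∀ {a b c} → a Fin.< b → b Fin.< c →
          lookup S a ≡ true → lookup S b ≡ true → lookup S c ≡ true → Size S

size : ∀ {t} (S : Vec Bool t) → Size S
size [] = none refl
size (false ∷ S) with size S
... | none eq = none (cong (false ∷_) eq)
... | one a p Sa = one (suc a) (λ v → trans (*-identityˡ _) (p (v ∘ suc))) Sa
... | two a<b p Sa Sb = two (s≤s a<b) (λ v → trans (*-identityˡ _) (p (v ∘ suc))) Sa Sb
... | three a<b b<c Sa Sb Sc = three (s≤s a<b) (s≤s b<c) Sa Sb Sc
size {suc t} (true ∷ S) with size S
... | none refl = one zero
        (λ v → trans (cong (v zero *_) (∏-one (mask S (v ∘ suc))
          (λ a → cong (λ b → if b then v (suc a) else 1ℚ) (lookup-replicate a false)))) (*-identityʳ (v zero))) refl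
... | one a p Sa = two {a = zero} {b = suc a} (s≤s z≤n) (λ v → cong (v zero *_) (p (v ∘ suc))) refl Sa
... | two {a} {b} a<b p Sa Sb = three {a = zero} {b = suc a} {c = suc b} (s≤s z≤n) (s≤s a<b) refl Sa Sb
... | three a<b b<c Sa Sb Sc = three (s≤s a<b) (s≤s b<c) Sa Sb Sc

-- A product over `Fin t`, so that `∏-distrib-*` can pull one factor `2` out of every index.
2^ : ℕ → ℚ
2^ t = ∏ {t} (λ _ → 2ℚ)

0≤2 : 0ℚ ≤ 2ℚ
0≤2 = nonNegative⁻¹ 2ℚ

0≤2^ : ∀ t → 0ℚ ≤ 2^ t
0≤2^ t = ∏-nonneg {t} (λ _ → 2ℚ) (λ _ → 0≤2)

2^*𝔼-suc : ∀ t (G : Fun (suc t)) → 2^ (suc t) * 𝔼 (suc t) G ≡ 2^ t * 𝔼 t (G ↾ false) + 2^ t * 𝔼 t (G ↾ true)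
2^*𝔼-suc t G = trans (cong (2^ (suc t) *_) (𝔼-suc t G))
  (solve 3 (λ p a b → (con 2ℚ :* p) :* (con ½ :* (a :+ b)) := p :* a :+ p :* b) refl
    (2^ t) (𝔼 t (G ↾ false)) (𝔼 t (G ↾ true)))

-- `2^ t * 𝔼 t G` is the sum of `G` over all subsets; without the empty one, fewer than `2^ t` terms
-- remain, each at most `B` in absolute value.
sum-near-empty : ∀ t {B} (G : Fun t) → (∀ S → S ≡ replicate t false ⊎ ∣ G S ∣ ≤ B) → 0ℚ ≤ B →
  ∣ 2^ t * 𝔼 t G - G (replicate t false) ∣ ≤ 2^ t * B
sum-near-empty zero {B} G p 0≤B =
  subst₂ (λ a b → ∣ a ∣ ≤ b)
    (sym (trans (cong (λ a → 1ℚ * a - G []) (𝔼-zero G)) (solve 1 (λ a → con 1ℚ :* a :- a := con 0ℚ) refl (G []))))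
    (sym (*-identityˡ B)) 0≤B
sum-near-empty (suc t) {B} G p 0≤B = subst₂ (λ a b → ∣ a ∣ ≤ b) eq
    (solve 2 (λ a b → a :* b :+ a :* b := con 2ℚ :* a :* b) refl (2^ t) B)
    (∣+∣≤ {2^ t * 𝔼 t G₀ - G₀ (replicate t false)} {2^ t * 𝔼 t G₁} (sum-near-empty t G₀ p₀ 0≤B)
      (subst (λ a → ∣ 2^ t * 𝔼 t G₁ ∣ ≤ 2^ t * a) (𝔼-const t B)
        (∣*∣≤ {2^ t} {𝔼 t G₁} (≤-reflexive (0≤p⇒∣p∣≡p (0≤2^ t))) (𝔼-∣∣ t p₁))))
  where
  G₀ = G ↾ false
  G₁ = G ↾ true
  p₀ : ∀ S → S ≡ replicate t false ⊎ ∣ G₀ S ∣ ≤ B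
  p₀ S = Sum.map₁ (cong Vec.tail) (p (false ∷ S))
  p₁ : ∀ S → ∣ G₁ S ∣ ≤ B
  p₁ S with p (true ∷ S)
  ... | inj₂ b = b
  eq : (2^ t * 𝔼 t G₀ - G₀ (replicate t false)) + 2^ t * 𝔼 t G₁ ≡ 2^ (suc t) * 𝔼 (suc t) G - G (replicate (suc t) false)
  eq = trans (solve 3 (λ a b c → (a :- b) :+ c := (a :+ c) :- b) refl (2^ t * 𝔼 t G₀) (G₀ (replicate t false)) (2^ t * 𝔼 t G₁))
         (cong (λ a → a - G₀ (replicate t false)) (sym (2^*𝔼-suc t G)))

-- Pairwise independent codes

-- For bits, these vanishing sign moments say that each position is uniform and any two positions
-- are independent.
record PairwiseIndependent {k t} (C : Point k → Vec Bool t) : Set where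
  field
    mean₁ : ∀ a → 𝔼 k (λ x → sgn (lookup (C x) a)) ≡ 0ℚ
    mean₂ : ∀ {a b} → a Fin.< b → 𝔼 k (λ x → sgn (lookup (C x) a) * sgn (lookup (C x) b)) ≡ 0ℚ

𝔼-affine : ∀ k (s : Fun k) → 𝔼 k s ≡ 0ℚ → ∀ u v → 𝔼 k (λ x → u + s x * v) ≡ u
𝔼-affine k s p u v = begin
  𝔼 k (λ x → u + s x * v)
    ≡⟨ 𝔼-+ k (λ _ → u) (λ x → s x * v) ⟩
  𝔼 k (λ _ → u) + 𝔼 k (λ x → s x * v)
    ≡⟨ cong₂ _+_ (𝔼-const k u) (trans (𝔼-cong k (λ x → *-comm (s x) v)) (𝔼-* k v s)) ⟩
  u + v * 𝔼 k s
    ≡⟨ cong (λ a → u + v * a) p ⟩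
  u + v * 0ℚ
    ≡⟨ solve 2 (λ u v → u :+ v :* con 0ℚ := u) refl u v ⟩
  u ∎
  where open ≡-Reasoning

𝔼-affine₂ : ∀ k (s r : Fun k) → 𝔼 k s ≡ 0ℚ → 𝔼 k r ≡ 0ℚ → 𝔼 k (λ x → s x * r x) ≡ 0ℚ →
  ∀ u v u′ v′ → 𝔼 k (λ x → (u + s x * v) * (u′ + r x * v′)) ≡ u * u′
𝔼-affine₂ k s r p p′ p″ u v u′ v′ = begin
  𝔼 k (λ x → (u + s x * v) * (u′ + r x * v′))
    -- The `0ℚ` in front brings the cross terms to the shape of `𝔼-affine`.
    ≡⟨ 𝔼-cong k (λ x → solve 6 (λ s r u v u′ v′ →
         (u :+ s :* v) :* (u′ :+ r :* v′) := u :* (u′ :+ r :* v′) :+ (con 0ℚ :+ s :* (v :* u′) :+ s :* r :* (v :* v′))) refl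
         (s x) (r x) u v u′ v′) ⟩
  𝔼 k (λ x → u * (u′ + r x * v′) + (0ℚ + s x * (v * u′) + s x * r x * (v * v′)))
    ≡⟨ 𝔼-+ k (λ x → u * (u′ + r x * v′)) (λ x → 0ℚ + s x * (v * u′) + s x * r x * (v * v′)) ⟩
  𝔼 k (λ x → u * (u′ + r x * v′)) + 𝔼 k (λ x → 0ℚ + s x * (v * u′) + s x * r x * (v * v′))
    ≡⟨ cong₂ _+_ (trans (𝔼-* k u (λ x → u′ + r x * v′)) (cong (u *_) (𝔼-affine k r p′ u′ v′))) rest ⟩
  u * u′ + 0ℚ
    ≡⟨ +-identityʳ (u * u′) ⟩
  u * u′ ∎
  where
  open ≡-Reasoning
  rest : 𝔼 k (λ x → 0ℚ + s x * (v * u′) + s x * r x * (v * v′)) ≡ 0ℚ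
  rest = trans (𝔼-+ k (λ x → 0ℚ + s x * (v * u′)) (λ x → s x * r x * (v * v′)))
    (trans (cong₂ _+_ (𝔼-affine k s p 0ℚ (v * u′))
      (trans (𝔼-cong k (λ x → sym (+-identityˡ (s x * r x * (v * v′))))) (𝔼-affine k (λ x → s x * r x) p″ 0ℚ (v * v′))))
      refl)

-- Expected products at correlated points

module _ {k t} (C : Point k → Vec Bool t) where

  slice : ∀ {n} → (Fin t → Fun (suc n)) → Point k → Fin t → Fun n
  slice h x a = h a ↾ lookup (C x) a

  -- The expectation of ∏ₐ hₐ(Xₐ), where each coordinate of (X₁, …, Xₜ) is, with probability ½ each,
  -- uniform in {0,1}ᵗ or a random codeword.  The first case averages every hₐ separately.
  Φ : ∀ n → (Fin t → Fun n) → ℚ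
  Φ zero    h = ∏ (λ a → h a [])
  Φ (suc n) h = ½ * (Φ n (λ a → av (h a)) + 𝔼 k (λ x → Φ n (slice h x)))

  Φ-cong : ∀ n {g h : Fin t → Fun n} → (∀ a x → g a x ≡ h a x) → Φ n g ≡ Φ n h
  Φ-cong zero p = ∏-cong (λ a → p a [])
  Φ-cong (suc n) p = cong₂ (λ a b → ½ * (a + b))
    (Φ-cong n (λ a x → cong₂ (λ c d → ½ * (c + d)) (p a (false ∷ x)) (p a (true ∷ x))))
    (𝔼-cong k (λ x → Φ-cong n (λ a z → p a (lookup (C x) a ∷ z))))

  Φ-scale : ∀ n (κ : Fin t → ℚ) h → Φ n (λ a x → κ a * h a x) ≡ ∏ κ * Φ n h
  Φ-scale zero κ h = ∏-distrib-* κ (λ a → h a [])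
  Φ-scale (suc n) κ h = begin
    ½ * (Φ n (λ a → av (λ x → κ a * h a x)) + 𝔼 k (λ x → Φ n (λ a z → κ a * slice h x a z)))
      ≡⟨ cong₂ (λ a b → ½ * (a + b))
           (trans (Φ-cong n (λ a x → solve 3 (λ k a b → con ½ :* (k :* a :+ k :* b) := k :* (con ½ :* (a :+ b))) refl
                     (κ a) (h a (false ∷ x)) (h a (true ∷ x))))
                  (Φ-scale n κ (λ a → av (h a))))
           (trans (𝔼-cong k (λ x → Φ-scale n κ (slice h x))) (𝔼-* k (∏ κ) (λ x → Φ n (slice h x)))) ⟩
    ½ * (∏ κ * Φ n (λ a → av (h a)) + ∏ κ * 𝔼 k (λ x → Φ n (slice h x)))
      ≡⟨ solve 3 (λ k a b → con ½ :* (k :* a :+ k :* b) := k :* (con ½ :* (a :+ b))) refl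
           (∏ κ) (Φ n (λ a → av (h a))) (𝔼 k (λ x → Φ n (slice h x))) ⟩
    ∏ κ * Φ (suc n) h ∎
    where open ≡-Reasoning

  -- `Φ` is multilinear in the functions, so averages in all arguments expand as in `∏-av`. This
  -- serves the expansion into `av` and `df`, and it identifies restriction by independent random
  -- bits with averaging.
  Φ-av : ∀ n (v : Fin t → Bool → Fun n) →
    Φ n (λ a x → ½ * (v a false x + v a true x)) ≡ 𝔼 t (λ S → Φ n (λ a → v a (lookup S a)))
  Φ-av zero v = ∏-av (λ a b → v a b [])
  Φ-av (suc n) v = begin
    ½ * (Φ n (λ a → av (λ x → ½ * (v a false x + v a true x))) + 𝔼 k (λ x → Φ n (slice (λ a x → ½ * (v a false x + v a true x)) x)))
      ≡⟨ cong₂ (λ a b → ½ * (a + b))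
           (trans (Φ-cong n (λ a x → solve 4 (λ a b c d → con ½ :* (con ½ :* (a :+ b) :+ con ½ :* (c :+ d)) := con ½ :* (con ½ :* (a :+ c) :+ con ½ :* (b :+ d))) refl
                     (v a false (false ∷ x)) (v a true (false ∷ x)) (v a false (true ∷ x)) (v a true (true ∷ x))))
                  (Φ-av n (λ a b → av (v a b))))
           (trans (𝔼-cong k (λ x → Φ-av n (λ a b → v a b ↾ lookup (C x) a)))
                  (𝔼-swap k t (λ x S → Φ n (slice (λ a → v a (lookup S a)) x)))) ⟩
    ½ * (𝔼 t A₁ + 𝔼 t A₂)
      ≡⟨ sym (trans (𝔼-* t ½ (λ S → A₁ S + A₂ S)) (cong (½ *_) (𝔼-+ t A₁ A₂))) ⟩
    𝔼 t (λ S → Φ (suc n) (λ a → v a (lookup S a))) ∎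
    where
    open ≡-Reasoning
    A₁ A₂ : Fun t
    A₁ S = Φ n (λ a → av (v a (lookup S a)))
    A₂ S = 𝔼 k (λ x → Φ n (slice (λ a → v a (lookup S a)) x))

  module _ (PI : PairwiseIndependent C) {Λ δ : ℚ} (0≤δ : 0ℚ ≤ δ) (0≤Λ : 0ℚ ≤ Λ) (Λδ≡1 : Λ * δ ≡ 1ℚ) where
    open PairwiseIndependent PI

    -- The AM-GM bound in terms of squared norms, with `Λ` in the role of `1/δ`: one small norm
    -- among the first two makes up for `Λ`.
    Q : ℚ → ℚ → ℚ → ℚ
    Q a b c = ½ * (Λ * (a * b) + δ * c)

    -- Expanding (Λ a b − c)² ≥ 0 and multiplying by δ = 1/Λ.
    ∣abc∣≤Q : ∀ a b c → ∣ a ∣ * (∣ b ∣ * ∣ c ∣) ≤ Q (a * a) (b * b) (c * c)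
    ∣abc∣≤Q a b c = subst (_ ≤_)
        (cong₃ (∣a∣²≡a² a) (∣a∣²≡a² b) (∣a∣²≡a² c))
        (lemma (∣ a ∣) (∣ b ∣) (∣ c ∣))
      where
      cong₃ : ∀ {a b c a′ b′ c′} → a ≡ a′ → b ≡ b′ → c ≡ c′ → Q a b c ≡ Q a′ b′ c′
      cong₃ refl refl refl = refl
      lemma : ∀ a b c → a * (b * c) ≤ Q (a * a) (b * b) (c * c)
      lemma a b c = ≤-add (*-nonneg 0≤½ (*-nonneg 0≤δ (square-nonneg (Λ * (a * b) - c)))) (begin
        a * (b * c) + ½ * (δ * ((Λ * (a * b) - c) * (Λ * (a * b) - c)))
          ≡⟨ solve 5 (λ a b c l d →
               a :* (b :* c) :+ con ½ :* (d :* ((l :* (a :* b) :- c) :* (l :* (a :* b) :- c))) :=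
               (con 1ℚ :- l :* d) :* (a :* (b :* c)) :+
               con ½ :* (l :* d :* (l :* ((a :* a) :* (b :* b))) :+ d :* (c :* c))) refl a b c Λ δ ⟩
        (1ℚ - Λ * δ) * (a * (b * c)) + ½ * (Λ * δ * (Λ * ((a * a) * (b * b))) + δ * (c * c))
          ≡⟨ cong (λ e → (1ℚ - e) * (a * (b * c)) + ½ * (e * (Λ * ((a * a) * (b * b))) + δ * (c * c))) Λδ≡1 ⟩
        (1ℚ - 1ℚ) * (a * (b * c)) + ½ * (1ℚ * (Λ * ((a * a) * (b * b))) + δ * (c * c))
          ≡⟨ solve 3 (λ p q r → (con 1ℚ :- con 1ℚ) :* p :+ con ½ :* (con 1ℚ :* q :+ r) := con ½ :* (q :+ r)) refl
               (a * (b * c)) (Λ * ((a * a) * (b * b))) (δ * (c * c)) ⟩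
        Q (a * a) (b * b) (c * c) ∎)
        where open ≡-Reasoning

    -- The noise rate enters only through ½ ≤ ϱ and ½ ≤ ϱ², which make the difference below nonnegative.
    Q-contract : ∀ {A B D a b d} → 0ℚ ≤ A → 0ℚ ≤ B → 0ℚ ≤ a → 0ℚ ≤ b → 0ℚ ≤ d →
      ½ * (Q A B D + Q (A + a) (B + b) (D + d)) ≤ Q (A + ϱ * a) (B + ϱ * b) (D + ϱ * d)
    Q-contract {A} {B} {D} {a} {b} {d} 0≤A 0≤B 0≤a 0≤b 0≤d = ≤-add
      (*-nonneg 0≤½ (+-nonneg
        (*-nonneg 0≤Λ (+-nonneg
          (*-nonneg (nonNegative⁻¹ ¼) (+-nonneg (*-nonneg 0≤A 0≤b) (*-nonneg 0≤a 0≤B)))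
          (*-nonneg (nonNegative⁻¹ (¼ * ¼)) (*-nonneg 0≤a 0≤b))))
        (*-nonneg 0≤δ (*-nonneg (nonNegative⁻¹ ¼) 0≤d))))
      (solve 8 (λ A B D a b d l e →
         con ½ :* (con ½ :* (l :* (A :* B) :+ e :* D) :+ con ½ :* (l :* ((A :+ a) :* (B :+ b)) :+ e :* (D :+ d)))
         :+ con ½ :* (l :* (con ¼ :* (A :* b :+ a :* B) :+ con (¼ * ¼) :* (a :* b)) :+ e :* (con ¼ :* d))
         := con ½ :* (l :* ((A :+ con ϱ :* a) :* (B :+ con ϱ :* b)) :+ e :* (D :+ con ϱ :* d))) refl
         A B D a b d Λ δ)

    -- Pairwise independence makes the average of the product over codewords the product of the averages.
    ∣Φ∣≤Q : ∀ n h → (∀ a → Bounded (h a)) → ∀ {a b c} → a Fin.< b → b Fin.< c →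
      ∣ Φ n h ∣ ≤ Q (stab ϱ n (h a)) (stab ϱ n (h b)) (stab ϱ n (h c))
    ∣Φ∣≤Q zero h p {a} {b} {c} a<b b<c =
      ≤-trans (∣∏∣≤₃ (λ a → h a []) (λ a → p a []) a<b b<c) (∣abc∣≤Q (h a []) (h b []) (h c []))
    ∣Φ∣≤Q (suc n) h p {a} {b} {c} a<b b<c = ≤-trans
      (∣½*∣≤ (∣+∣≤ {Φ n (λ a → av (h a))} {𝔼 k (λ x → Φ n (slice h x))}
        (∣Φ∣≤Q n (λ a → av (h a)) (λ a → av-bounded (p a)) a<b b<c)
        (≤-trans (𝔼-∣∣ k (λ x → ∣Φ∣≤Q n (slice h x) (λ a z → p a (lookup (C x) a ∷ z)) a<b b<c))
          (≤-reflexive average))))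
      (Q-contract (0≤E a) (0≤E b) (0≤D a) (0≤D b) (0≤D c))
      where
      E D V : Fin t → ℚ
      E a = stab ϱ n (av (h a))
      D a = stab ϱ n (df (h a))
      V a = ½ * (stab ϱ n (h a ↾ false) - stab ϱ n (h a ↾ true))
      0≤E : ∀ a → 0ℚ ≤ E a
      0≤E a = stab-nonneg 0≤ϱ n (av (h a))
      0≤D : ∀ a → 0ℚ ≤ D a
      0≤D a = stab-nonneg 0≤ϱ n (df (h a))
      s : Fin t → Fun k
      s a x = sgn (lookup (C x) a)
      M : Fin t → Fun k
      M a x = stab ϱ n (slice h x a)
      M≡ : ∀ a x → M a x ≡ (E a + D a) + s a x * V a
      M≡ a x = stab-slice ϱ n (h a) (lookup (C x) a)
      open ≡-Reasoning
      average : 𝔼 k (λ x → Q (M a x) (M b x) (M c x)) ≡ Q (E a + D a) (E b + D b) (E c + D c)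
      average = begin
        𝔼 k (λ x → ½ * (Λ * (M a x * M b x) + δ * M c x))
          ≡⟨ 𝔼-* k ½ (λ x → Λ * (M a x * M b x) + δ * M c x) ⟩
        ½ * 𝔼 k (λ x → Λ * (M a x * M b x) + δ * M c x)
          ≡⟨ cong (½ *_) (𝔼-+ k (λ x → Λ * (M a x * M b x)) (λ x → δ * M c x)) ⟩
        ½ * (𝔼 k (λ x → Λ * (M a x * M b x)) + 𝔼 k (λ x → δ * M c x))
          ≡⟨ cong₂ (λ u v → ½ * (u + v)) (𝔼-* k Λ (λ x → M a x * M b x)) (𝔼-* k δ (M c)) ⟩
        ½ * (Λ * 𝔼 k (λ x → M a x * M b x) + δ * 𝔼 k (M c))
          ≡⟨ cong₂ (λ u v → ½ * (Λ * u + δ * v))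
               (trans (𝔼-cong k (λ x → cong₂ _*_ (M≡ a x) (M≡ b x)))
                 (𝔼-affine₂ k (s a) (s b) (mean₁ a) (mean₁ b) (mean₂ a<b) (E a + D a) (V a) (E b + D b) (V b)))
               (trans (𝔼-cong k (M≡ c)) (𝔼-affine k (s c) (mean₁ c) (E c + D c) (V c))) ⟩
        Q (E a + D a) (E b + D b) (E c + D c) ∎

-- Sums over Fin t

sum-scale : ∀ {t} k (v : Fin t → ℚ) → sum (λ a → k * v a) ≡ k * sum v
sum-scale {zero} k v = sym (*-zeroʳ k)
sum-scale {suc t} k v = trans (cong (_+_ (k * v zero)) (sum-scale k (v ∘ suc)))
  (sym (*-distribˡ-+ k (v zero) (sum (v ∘ suc))))

sum-nonneg : ∀ {t} {v : Fin t → ℚ} → (∀ a → 0ℚ ≤ v a) → 0ℚ ≤ sum v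
sum-nonneg {zero} p = ≤-refl
sum-nonneg {suc t} p = +-nonneg (p zero) (sum-nonneg (p ∘ suc))

sum-mono : ∀ {t} {u v : Fin t → ℚ} → (∀ a → u a ≤ v a) → sum u ≤ sum v
sum-mono {zero} p = ≤-refl
sum-mono {suc t} p = +-mono-≤ (p zero) (sum-mono (p ∘ suc))

term≤sum : ∀ {t} {v : Fin t → ℚ} → (∀ a → 0ℚ ≤ v a) → ∀ a → v a ≤ sum v
term≤sum {suc t} {v} p zero = ≤-add (sum-nonneg (p ∘ suc)) refl
term≤sum {suc t} {v} p (suc a) = ≤-trans (term≤sum (p ∘ suc) a)
  (≤-add (p zero) (+-comm (sum (v ∘ suc)) (v zero)))

-- Averaging out the coordinates

module _ {k t} (C : Point k → Vec Bool t) where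

  signs : Point k → Fin t → ℚ
  signs x a = sgn (lookup (C x) a)

  select : ∀ {n} → (Fin t → Fun (suc n)) → Point t → Fin t → Fun n
  select h S a = if lookup S a then df (h a) else av (h a)

  -- The influence of a coordinate is measured after the earlier ones are averaged out, in the order
  -- in which `Φ` consumes them; at no coordinate do two functions exceed `θ`.
  NoShare : ℚ → ∀ n → (Fin t → Fun n) → Set
  NoShare θ zero    h = ⊤
  NoShare θ (suc n) h =
    (∀ {a b} → a Fin.< b → stab ϱ n (df (h a)) ≤ θ ⊎ stab ϱ n (df (h b)) ≤ θ) × NoShare θ n (λ a → av (h a))

  -- Each restriction is `av` plus a codeword sign times `df`. `Φ-av` averages over subsets where a
  -- sum is wanted, hence a factor `2` in each argument and `2^ t` outside.
  slice-expand : ∀ n h x → Φ C n (slice C h x) ≡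
    𝔼 t (λ S → 2^ t * (∏ (mask S (signs x)) * Φ C n (select h S)))
  slice-expand n h x = begin
    Φ C n (slice C h x)
      ≡⟨ Φ-cong C n (λ a z → trans (split (h a) (lookup (C x) a) z)
           (solve 3 (λ s u v → u :+ s :* v := con ½ :* (con 2ℚ :* con 1ℚ :* u :+ con 2ℚ :* s :* v)) refl
             (signs x a) (av (h a) z) (df (h a) z))) ⟩
    Φ C n (λ a z → ½ * (v a false z + v a true z))
      ≡⟨ Φ-av C n v ⟩
    𝔼 t (λ S → Φ C n (λ a z → 2ℚ * mask S (signs x) a * select h S a z))
      ≡⟨ 𝔼-cong t (λ S → trans (Φ-scale C n (λ a → 2ℚ * mask S (signs x) a) (select h S))
           (trans (cong (_* Φ C n (select h S)) (∏-distrib-* (λ _ → 2ℚ) (mask S (signs x))))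
                  (*-assoc (2^ t) (∏ (mask S (signs x))) (Φ C n (select h S))))) ⟩
    𝔼 t (λ S → 2^ t * (∏ (mask S (signs x)) * Φ C n (select h S))) ∎
    where
    open ≡-Reasoning
    v : Fin t → Bool → Fun n
    v a b z = 2ℚ * (if b then signs x a else 1ℚ) * (if b then df (h a) else av (h a)) z

  module _ (PI : PairwiseIndependent C) where
    open PairwiseIndependent PI

    -- In the expansion over S ⊆ [t], the nonempty S with at most two elements vanish by pairwise
    -- independence, and S = ∅ gives the subtracted term.
    one-step : ∀ n h {B} → 0ℚ ≤ B →
      (∀ S {a b c} → a Fin.< b → b Fin.< c → lookup S a ≡ true → lookup S b ≡ true → lookup S c ≡ true →
        ∣ Φ C n (select h S) ∣ ≤ B) →
      ∣ 𝔼 k (λ x → Φ C n (slice C h x)) - Φ C n (λ a → av (h a)) ∣ ≤ 2^ t * B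
    one-step n h {B} 0≤B bound =
      subst₂ (λ u v → ∣ u - v ∣ ≤ 2^ t * B) (sym expand) empty (sum-near-empty t G small 0≤B)
      where
      m : Fun t
      m S = 𝔼 k (λ x → ∏ (mask S (signs x)))
      G : Fun t
      G S = m S * Φ C n (select h S)
      expand : 𝔼 k (λ x → Φ C n (slice C h x)) ≡ 2^ t * 𝔼 t G
      expand = begin
        𝔼 k (λ x → Φ C n (slice C h x))
          ≡⟨ 𝔼-cong k (slice-expand n h) ⟩
        𝔼 k (λ x → 𝔼 t (λ S → 2^ t * (∏ (mask S (signs x)) * Φ C n (select h S))))
          ≡⟨ 𝔼-swap k t (λ x S → 2^ t * (∏ (mask S (signs x)) * Φ C n (select h S))) ⟩
        𝔼 t (λ S → 𝔼 k (λ x → 2^ t * (∏ (mask S (signs x)) * Φ C n (select h S))))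
          ≡⟨ 𝔼-cong t (λ S → trans (𝔼-* k (2^ t) (λ x → ∏ (mask S (signs x)) * Φ C n (select h S)))
               (cong (2^ t *_) (trans (𝔼-cong k (λ x → *-comm (∏ (mask S (signs x))) (Φ C n (select h S))))
                 (trans (𝔼-* k (Φ C n (select h S)) (λ x → ∏ (mask S (signs x))))
                   (*-comm (Φ C n (select h S)) (m S)))))) ⟩
        𝔼 t (λ S → 2^ t * G S)
          ≡⟨ 𝔼-* t (2^ t) G ⟩
        2^ t * 𝔼 t G ∎
        where open ≡-Reasoning
      empty : G (replicate t false) ≡ Φ C n (λ a → av (h a))
      empty = trans (cong₂ _*_
          (trans (𝔼-cong k (λ x → ∏-one (mask (replicate t false) (signs x))
            (λ a → cong (λ b → if b then signs x a else 1ℚ) (lookup-replicate a false)))) (𝔼-const k 1ℚ))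
          (Φ-cong C n (λ a z → cong (λ b → (if b then df (h a) else av (h a)) z) (lookup-replicate a false))))
        (*-identityˡ (Φ C n (λ a → av (h a))))
      vanish : ∀ S → m S ≡ 0ℚ → ∣ G S ∣ ≤ B
      vanish S eq = subst (λ u → ∣ u ∣ ≤ B)
        (sym (trans (cong (_* Φ C n (select h S)) eq) (*-zeroˡ (Φ C n (select h S))))) 0≤B
      mask-bounded : ∀ S x a → ∣ mask S (signs x) a ∣ ≤ 1ℚ
      mask-bounded S x a with lookup S a
      ... | true  = ≤-reflexive (∣sgn∣ (lookup (C x) a))
      ... | false = ≤-refl
      small : ∀ S → S ≡ replicate t false ⊎ ∣ G S ∣ ≤ B
      small S with size S
      ... | none eq = inj₁ eq
      ... | one a p _ = inj₂ (vanish S (trans (𝔼-cong k (λ x → p (signs x))) (mean₁ a)))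
      ... | two a<b p _ _ = inj₂ (vanish S (trans (𝔼-cong k (λ x → p (signs x))) (mean₂ a<b)))
      ... | three a<b b<c Sa Sb Sc = inj₂ (dropˡ {m S}
              (subst (∣ m S ∣ ≤_) (𝔼-const k 1ℚ) (𝔼-∣∣ k (λ x → ∣∏∣≤1 (mask S (signs x)) (mask-bounded S x))))
              (bound S a<b b<c Sa Sb Sc))

    module _ {Λ δ : ℚ} (0≤δ : 0ℚ ≤ δ) (0≤Λ : 0ℚ ≤ Λ) (Λδ≡1 : Λ * δ ≡ 1ℚ) where

      -- Chosen so that `½ * 3/2` equals `ϱ`, which makes the cost of one coordinate in `Φ≈∏𝔼`
      -- telescope exactly.
      3/2 : ℚ
      3/2 = + 3 / 2

      Q-small : ∀ {A B D s} → 0ℚ ≤ A → 0ℚ ≤ B → A ≤ s → B ≤ s → D ≤ s → A ≤ δ * δ ⊎ B ≤ δ * δ →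
        Q C PI 0≤δ 0≤Λ Λδ≡1 A B D ≤ 3/2 * (δ * s)
      Q-small {A} {B} {D} {s} 0≤A 0≤B A≤s B≤s D≤s small = begin
        ½ * (Λ * (A * B) + δ * D)
          ≤⟨ *-monoˡ 0≤½ (+-mono-≤ (*-monoˡ 0≤Λ (AB≤ small)) (*-monoˡ 0≤δ D≤s)) ⟩
        ½ * (Λ * (δ * δ * (s + s)) + δ * s)
          ≡⟨ solve 3 (λ l d s → con ½ :* (l :* (d :* d :* (s :+ s)) :+ d :* s) := l :* d :* (d :* s) :+ con ½ :* (d :* s)) refl Λ δ s ⟩
        Λ * δ * (δ * s) + ½ * (δ * s)
          ≡⟨ cong (λ e → e * (δ * s) + ½ * (δ * s)) Λδ≡1 ⟩
        1ℚ * (δ * s) + ½ * (δ * s)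
          ≡⟨ solve 1 (λ a → con 1ℚ :* a :+ con ½ :* a := con 3/2 :* a) refl (δ * s) ⟩
        3/2 * (δ * s) ∎
        where
        open ≤-Reasoning
        0≤s : 0ℚ ≤ s
        0≤s = ≤-trans 0≤A A≤s
        s≤2s : s ≤ s + s
        s≤2s = ≤-add 0≤s refl
        -- Doubling `s` is deliberate slack: it raises the constant from `1` to `3/2`.
        AB≤ : A ≤ δ * δ ⊎ B ≤ δ * δ → A * B ≤ δ * δ * (s + s)
        AB≤ (inj₁ A≤) = *-mono 0≤A (+-nonneg 0≤s 0≤s) A≤ (≤-trans B≤s s≤2s)
        AB≤ (inj₂ B≤) = subst (_≤ δ * δ * (s + s)) (*-comm B A)
                          (*-mono 0≤B (+-nonneg 0≤s 0≤s) B≤ (≤-trans A≤s s≤2s))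

      -- Averaging out one coordinate costs 2ᵗ ¾ δ Σₐ stab (df hₐ); as ϱ stab (df hₐ) = stab hₐ − stab (av hₐ),
      -- the costs telescope.
      Φ≈∏𝔼 : ∀ n h → (∀ a → Bounded (h a)) → NoShare (δ * δ) n h →
        ∣ Φ C n h - ∏ (λ a → 𝔼 n (h a)) ∣ ≤ 2^ t * δ * sum (λ a → stab ϱ n (h a))
      Φ≈∏𝔼 zero h p _ = subst (λ u → ∣ u ∣ ≤ 2^ t * δ * sum (λ a → stab ϱ 0 (h a)))
        (sym (trans (cong (λ u → ∏ (λ a → h a []) - u) (∏-cong (λ a → 𝔼-zero (h a)))) (+-inverseʳ (∏ (λ a → h a [])))))
        (*-nonneg (*-nonneg (0≤2^ t) 0≤δ) (sum-nonneg (λ a → square-nonneg (h a []))))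
      Φ≈∏𝔼 (suc n) h p (small , rest) = subst₂ (λ u v → ∣ u ∣ ≤ v) lhs rhs
        -- `Φ C (suc n) h` is `½ * (Y + X)`, so replacing it by `Y` costs half of the `one-step`
        -- error; the induction hypothesis covers `Y - Z`.
        (∣+∣≤ {½ * (X - Y)} {Y - Z} (∣½*∣≤ {X - Y} (one-step n h 0≤B bound))
                (Φ≈∏𝔼 n (λ a → av (h a)) (λ a → av-bounded (p a)) rest))
        where
        E D : Fin t → ℚ
        E a = stab ϱ n (av (h a))
        D a = stab ϱ n (df (h a))
        0≤D : ∀ a → 0ℚ ≤ D a
        0≤D a = stab-nonneg 0≤ϱ n (df (h a))
        X Y Z B : ℚ
        X = 𝔼 k (λ x → Φ C n (slice C h x))
        Y = Φ C n (λ a → av (h a))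
        Z = ∏ (λ a → 𝔼 n (av (h a)))
        B = 3/2 * (δ * sum D)
        0≤B : 0ℚ ≤ B
        0≤B = *-nonneg (nonNegative⁻¹ 3/2) (*-nonneg 0≤δ (sum-nonneg 0≤D))
        select-bounded : ∀ S a → Bounded (select h S a)
        select-bounded S a with lookup S a
        ... | true  = df-bounded (p a)
        ... | false = av-bounded (p a)
        selected : ∀ S a → lookup S a ≡ true → stab ϱ n (select h S a) ≡ D a
        selected S a eq = cong (λ b → stab ϱ n (if b then df (h a) else av (h a))) eq
        bound : ∀ S {a b c} → a Fin.< b → b Fin.< c → lookup S a ≡ true → lookup S b ≡ true → lookup S c ≡ true →
          ∣ Φ C n (select h S) ∣ ≤ B
        bound S {a} {b} {c} a<b b<c Sa Sb Sc = ≤-trans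
          (subst (∣ Φ C n (select h S) ∣ ≤_)
            (cong₃ (selected S a Sa) (selected S b Sb) (selected S c Sc))
            (∣Φ∣≤Q C PI 0≤δ 0≤Λ Λδ≡1 n (select h S) (select-bounded S) a<b b<c))
          (Q-small (0≤D a) (0≤D b) (term≤sum 0≤D a) (term≤sum 0≤D b) (term≤sum 0≤D c) (small a<b))
          where
          cong₃ : ∀ {a b c a′ b′ c′} → a ≡ a′ → b ≡ b′ → c ≡ c′ →
            Q C PI 0≤δ 0≤Λ Λδ≡1 a b c ≡ Q C PI 0≤δ 0≤Λ Λδ≡1 a′ b′ c′
          cong₃ refl refl refl = refl
        lhs : ½ * (X - Y) + (Y - Z) ≡ Φ C (suc n) h - ∏ (λ a → 𝔼 (suc n) (h a))
        lhs = trans (solve 3 (λ x y z → con ½ :* (x :- y) :+ (y :- z) := con ½ :* (y :+ x) :- z) refl X Y Z)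
          (cong (λ u → ½ * (Y + X) - u) (∏-cong (λ a → sym (𝔼-av n (h a)))))
        rhs : ½ * (2^ t * B) + 2^ t * δ * sum E ≡ 2^ t * δ * sum (λ a → stab ϱ (suc n) (h a))
        rhs = trans (solve 4 (λ q d e s → con ½ :* (q :* (con 3/2 :* (d :* s))) :+ q :* d :* e := q :* d :* (e :+ con ϱ :* s)) refl
                (2^ t) δ (sum E) (sum D))
          (cong (_*_ (2^ t * δ)) (sym (trans (sum-distrib-+ E (λ a → ϱ * D a)) (cong (_+_ (sum E)) (sum-scale ϱ D)))))

-- Fourier coefficients

coef : ∀ {n} → Fun n → Point n → ℚ
coef {n} h α = 𝔼 n (λ x → h x * χ α x)

-- Together with `coef-true`, this links the recursion of `stab` to sums over Fourier coefficients.
coef-false : ∀ {n} (h : Fun (suc n)) α → coef h (false ∷ α) ≡ coef (av h) α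
coef-false {n} h α = trans (𝔼-av n (λ x → h x * χ (false ∷ α) x))
  (𝔼-cong n (λ x → solve 3 (λ a b c → con ½ :* (a :* c :+ b :* c) := con ½ :* (a :+ b) :* c) refl
    (h (false ∷ x)) (h (true ∷ x)) (χ α x)))

sgn-not : ∀ b → sgn (not b) ≡ - sgn b
sgn-not true  = refl
sgn-not false = refl

coef-true : ∀ {n} (h : Fun (suc n)) α → coef h (true ∷ α) ≡ coef (df h) α
coef-true {n} h α = trans (𝔼-av n (λ x → h x * χ (true ∷ α) x))
  (𝔼-cong n (λ x → trans (cong (λ c → ½ * (h (false ∷ x) * χ α x + h (true ∷ x) * c)) (sgn-not (inner x)))
    (solve 3 (λ a b c → con ½ :* (a :* c :+ b :* :- c) := con ½ :* (a :- b) :* c) refl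
      (h (false ∷ x)) (h (true ∷ x)) (χ α x))))
  where
  inner : Point n → Bool
  inner x = Vec.foldr _ _xor_ false (Vec.zipWith _∧_ α x)

∑-cong : ∀ n {f g : Fun n} → (∀ x → f x ≡ g x) → ∑ n f ≡ ∑ n g
∑-cong n p = cong sumℚ (List.map-cong p (allPoints n))

∑-nonneg : ∀ n {f : Fun n} → (∀ x → 0ℚ ≤ f x) → 0ℚ ≤ ∑ n f
∑-nonneg zero p = +-nonneg (p []) ≤-refl
∑-nonneg (suc n) {f} p = subst (0ℚ ≤_) (sym (∑-suc n f))
  (+-nonneg (∑-nonneg n (λ x → p (false ∷ x))) (∑-nonneg n (λ x → p (true ∷ x))))

-- Low-degree weight and influences

square-if : Bool → ℚ → ℚ
square-if b a = if b then a * a else 0ℚ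

square-if-nonneg : ∀ b a → 0ℚ ≤ square-if b a
square-if-nonneg true  a = square-nonneg a
square-if-nonneg false a = ≤-refl

-- The Fourier weight of `h` on degrees at most `w`.
low : ℕ → ∀ {n} → Fun n → ℚ
low w {n} h = ∑ n (λ α → square-if (weight α ℕ.≤ᵇ w) (coef h α))

-- lowInfluence w i f is influence w i (sgn ∘ f), definitionally.
influence : ℕ → ∀ {n} → Fin n → Fun n → ℚ
influence w {n} i h = ∑ n (λ α → square-if (lookup α i ∧ (weight α ℕ.≤ᵇ w)) (coef h α))

suc-≤ᵇ : ∀ m n → (suc m ℕ.≤ᵇ suc n) ≡ (m ℕ.≤ᵇ n)
suc-≤ᵇ zero    n = refl
suc-≤ᵇ (suc m) n = refl

ϱ^ : ℕ → ℚ
ϱ^ w = ∏ {w} (λ _ → ϱ)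

0≤ϱ^ : ∀ w → 0ℚ ≤ ϱ^ w
0≤ϱ^ w = ∏-nonneg {w} (λ _ → ϱ) (λ _ → 0≤ϱ)

low-true : ∀ w n (h : Fun (suc n)) →
  ∑ n (λ α → square-if (suc (weight α) ℕ.≤ᵇ suc w) (coef h (true ∷ α))) ≡ low w (df h)
low-true w n h = ∑-cong n (λ α → cong₂ square-if (suc-≤ᵇ (weight α) w) (coef-true h α))

stab-ϱ≤stab-1 : ∀ n h → stab ϱ n h ≤ stab 1ℚ n h
stab-ϱ≤stab-1 zero h = ≤-refl
stab-ϱ≤stab-1 (suc n) h = +-mono-≤ (stab-ϱ≤stab-1 n (av h))
  (*-mono 0≤ϱ (stab-nonneg 0≤1 n (df h)) ϱ≤1 (stab-ϱ≤stab-1 n (df h)))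

-- Degrees up to `w` have damping at most `1`, higher ones at most `ϱ^ (suc w)`; `stab 1ℚ` is the
-- total Fourier weight.
stab≤low : ∀ w n h → stab ϱ n h ≤ low w h + ϱ^ (suc w) * stab 1ℚ n h
stab≤low w zero h = ≤-add (*-nonneg (0≤ϱ^ (suc w)) (square-nonneg (h [])))
  (cong (λ a → a + ϱ^ (suc w) * stab 1ℚ 0 h) (sym (trans (+-identityʳ (coef h [] * coef h [])) (cong₂ _*_ c c))))
  where
  c : coef h [] ≡ h []
  c = trans (𝔼-zero (λ x → h x * χ [] x)) (*-identityʳ (h []))
-- Sets containing the first coordinate have positive degree: they add only zeros to `low zero h`,
-- and all of `df h` goes into the tail.
stab≤low zero (suc n) h = begin
  stab ϱ n (av h) + ϱ * stab ϱ n (df h)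
    ≤⟨ +-mono-≤ (stab≤low zero n (av h)) (*-monoˡ 0≤ϱ (stab-ϱ≤stab-1 n (df h))) ⟩
  (low zero (av h) + ϱ^ 1 * stab 1ℚ n (av h)) + ϱ * stab 1ℚ n (df h)
    ≡⟨ solve 3 (λ l a b → (l :+ con (ϱ^ 1) :* a) :+ con ϱ :* b := l :+ con (ϱ^ 1) :* (a :+ con 1ℚ :* b)) refl
         (low zero (av h)) (stab 1ℚ n (av h)) (stab 1ℚ n (df h)) ⟩
  low zero (av h) + ϱ^ 1 * stab 1ℚ (suc n) h
    ≤⟨ +-monoˡ-≤ (ϱ^ 1 * stab 1ℚ (suc n) h) (≤-add {low zero (av h)} (∑-nonneg n (λ α → ≤-refl))
         (trans (cong (λ a → a + ∑ n (λ _ → 0ℚ)) (∑-cong n (λ α → cong (square-if (weight α ℕ.≤ᵇ 0)) (sym (coef-false h α)))))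
           (sym (∑-suc n (λ α → square-if (weight α ℕ.≤ᵇ 0) (coef h α)))))) ⟩
  low zero h + ϱ^ 1 * stab 1ℚ (suc n) h ∎
  where open ≤-Reasoning
stab≤low (suc w) (suc n) h = begin
  stab ϱ n (av h) + ϱ * stab ϱ n (df h)
    ≤⟨ +-mono-≤ (stab≤low (suc w) n (av h)) (*-monoˡ 0≤ϱ (stab≤low w n (df h))) ⟩
  (low (suc w) (av h) + ϱ * p * a) + ϱ * (low w (df h) + p * b)
    ≡⟨ solve 5 (λ l m p a b → (l :+ con ϱ :* p :* a) :+ con ϱ :* (m :+ p :* b) :=
          con ϱ :* m :+ (l :+ con ϱ :* p :* (a :+ con 1ℚ :* b))) refl (low (suc w) (av h)) (low w (df h)) p a b ⟩
  ϱ * low w (df h) + (low (suc w) (av h) + ϱ * p * (a + 1ℚ * b))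
    ≤⟨ +-monoˡ-≤ (low (suc w) (av h) + ϱ * p * (a + 1ℚ * b))
         (*-monoʳ-≤-nonNeg (low w (df h)) {{nonNegative (∑-nonneg n (λ α → square-if-nonneg (weight α ℕ.≤ᵇ w) (coef (df h) α)))}} ϱ≤1) ⟩
  1ℚ * low w (df h) + (low (suc w) (av h) + ϱ * p * (a + 1ℚ * b))
    ≡⟨ solve 3 (λ l m r → con 1ℚ :* m :+ (l :+ r) := (l :+ m) :+ r) refl (low (suc w) (av h)) (low w (df h)) (ϱ * p * (a + 1ℚ * b)) ⟩
  (low (suc w) (av h) + low w (df h)) + ϱ * p * (a + 1ℚ * b)
    ≡⟨ cong (λ e → e + ϱ * p * (a + 1ℚ * b)) (sym (trans (∑-suc n (λ α → square-if (weight α ℕ.≤ᵇ suc w) (coef h α)))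
         (cong₂ _+_ (∑-cong n (λ α → cong (square-if (weight α ℕ.≤ᵇ suc w)) (coef-false h α))) (low-true w n h)))) ⟩
  low (suc w) h + ϱ^ (suc (suc w)) * stab 1ℚ (suc n) h ∎
  where
  open ≤-Reasoning
  p a b : ℚ
  p = ϱ^ (suc w)
  a = stab 1ℚ n (av h)
  b = stab 1ℚ n (df h)

-- infl n i h = Σ ϱ^(|α|-1) ĥ(α)² over those α whose least element is i.
infl : ∀ n → Fin n → Fun n → ℚ
infl (suc n) zero    h = stab ϱ n (df h)
infl (suc n) (suc j) h = infl n j (av h)

-- The constant `c` affects only the coefficient of the empty set, which has no least element, and
-- the rest is quadratic in `k`.
infl-affine : ∀ n j c k (F h : Fun n) → (∀ x → h x ≡ c + k * F x) → infl n j h ≡ k * k * infl n j F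
infl-affine (suc n) zero c k F h p = trans
  (stab-cong ϱ n (λ x → trans (cong₂ (λ a b → ½ * (a - b)) (p (false ∷ x)) (p (true ∷ x)))
    (solve 4 (λ c k a b → con ½ :* ((c :+ k :* a) :- (c :+ k :* b)) := k :* (con ½ :* (a :- b))) refl
      c k (F (false ∷ x)) (F (true ∷ x)))))
  (stab-scale ϱ n k (df F))
infl-affine (suc n) (suc j) c k F h p = infl-affine n j c k (av F) (av h)
  (λ x → trans (cong₂ (λ a b → ½ * (a + b)) (p (false ∷ x)) (p (true ∷ x)))
    (solve 4 (λ c k a b → con ½ :* ((c :+ k :* a) :+ (c :+ k :* b)) := c :+ k :* (con ½ :* (a :+ b))) refl
      c k (F (false ∷ x)) (F (true ∷ x))))

-- Sets with least element `j` contain `j`. Those of size at most `suc w` enter the influence; for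
-- larger ones the damping exponent, one less than the size, is at least `suc w`.
infl≤influence : ∀ w n j h → infl n j h ≤ influence (suc w) j h + ϱ^ (suc w) * stab 1ℚ n h
infl≤influence w (suc n) zero h = ≤-trans (stab≤low w n (df h)) (+-mono-≤
  (≤-add {low w (df h)} (∑-nonneg n (λ α → ≤-refl)) (trans (+-comm (low w (df h)) (∑ n (λ _ → 0ℚ)))
    (trans (cong (_+_ (∑ n (λ _ → 0ℚ))) (sym (low-true w n h)))
      (sym (∑-suc n (λ α → square-if (lookup α zero ∧ (weight α ℕ.≤ᵇ suc w)) (coef h α)))))))
  (*-monoˡ (0≤ϱ^ (suc w)) (≤-add {stab 1ℚ n (df h)} (stab-nonneg 0≤1 n (av h))
    (solve 2 (λ a b → b :+ a := a :+ con 1ℚ :* b) refl (stab 1ℚ n (av h)) (stab 1ℚ n (df h))))))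
infl≤influence w (suc n) (suc j) h = ≤-trans (infl≤influence w n j (av h)) (+-mono-≤
  (≤-add {influence (suc w) j (av h)} (∑-nonneg n (λ α → square-if-nonneg (lookup α j ∧ (suc (weight α) ℕ.≤ᵇ suc w)) (coef h (true ∷ α))))
    (trans (cong (λ a → a + ∑ n (λ α → square-if (lookup α j ∧ (suc (weight α) ℕ.≤ᵇ suc w)) (coef h (true ∷ α))))
        (∑-cong n (λ α → cong (square-if (lookup α j ∧ (weight α ℕ.≤ᵇ suc w))) (sym (coef-false h α)))))
      (sym (∑-suc n (λ α → square-if (lookup α (suc j) ∧ (weight α ℕ.≤ᵇ suc w)) (coef h α))))))
  (*-monoˡ (0≤ϱ^ (suc w)) (≤-add {stab 1ℚ n (av h)} (*-nonneg 0≤1 (stab-nonneg 0≤1 n (df h))) refl)))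

-- Archimedean property

nat : ℕ → ℚ
nat n = + n / 1

nat-suc : ∀ n → nat (suc n) ≡ 1ℚ + nat n
nat-suc n = toℚᵘ-injective (ℚᵘ.≃-trans (toℚᵘ-fromℚᵘ (ℚᵘ.mkℚᵘ (+ suc n) 0))
  (ℚᵘ.≃-sym (ℚᵘ.≃-trans (toℚᵘ-homo-+ 1ℚ (nat n))
    (ℚᵘ.≃-trans (ℚᵘ.+-congʳ (toℚᵘ 1ℚ) (toℚᵘ-fromℚᵘ (ℚᵘ.mkℚᵘ (+ n) 0)))
      (ℚᵘ.*≡* (cong (λ i → (+ 1 ℤ.+ i) ℤ.* + 1) (ℤ.*-identityʳ (+ n))))))))

0≤nat : ∀ n → 0ℚ ≤ nat n
0≤nat n = nonNegative⁻¹ (nat n) {{normalize-nonNeg n 1}}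

-- A positive rational has numerator at least `1`, so its denominator is a witness.
archimedean : ∀ x → 0ℚ < x → ∃ λ d → 1ℚ ≤ x * nat d
archimedean x@(mkℚ (ℤ.+[1+ m ]) d c) _ = suc d , (begin
  1ℚ                    ≡⟨ sym (*-inverseˡ D) ⟩
  1/ D * D              ≤⟨ *-monoʳ-≤-nonNeg D 1/D≤x ⟩
  x * D                 ≡⟨ cong (x *_) (sym (↥p/↧p≡p D)) ⟩
  x * nat (suc d)       ∎)
  where
  open ≤-Reasoning
  D : ℚ
  D = mkℚ (ℤ.+[1+ d ]) 0 (Coprime.sym (Coprime.1-coprimeTo (suc d)))
  1/D≤x : 1/ D ≤ x
  1/D≤x = *≤* (ℤ.*-monoʳ-≤-nonNeg (+ suc d) {+ 1} {+ suc m} (ℤ.+≤+ (s≤s z≤n)))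
archimedean (mkℚ (+ 0) d c) (*<* 0<0) = contradiction 0<0 (ℤ.<-irrefl refl)
archimedean (mkℚ (ℤ.-[1+ m ]) d c) (*<* ())

-- Bernoulli's inequality `(4/3)^w ≥ 1 + w/3` with denominators cleared.
bernoulli : ∀ w → ϱ^ w * (nat 3 + nat w) ≤ nat 3
bernoulli zero = ≤-refl
bernoulli (suc w) = ≤-trans (≤-add (*-nonneg (0≤ϱ^ w) (*-nonneg (nonNegative⁻¹ ¼) (0≤nat w)))
    (trans (cong (λ e → ϱ * ϱ^ w * (nat 3 + e) + ϱ^ w * (¼ * nat w)) (nat-suc w))
      (solve 2 (λ p n → con ϱ :* p :* (con (nat 3) :+ (con 1ℚ :+ n)) :+ p :* (con ¼ :* n) := p :* (con (nat 3) :+ n)) refl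
        (ϱ^ w) (nat w))))
  (bernoulli w)

-- By `bernoulli` it suffices that `3 ≤ x * (3 + d)`, and `archimedean` for a third of `x` gives
-- `3 ≤ x * d`.
ϱ^-small : ∀ x → 0ℚ < x → ∃ λ w → ϱ^ w ≤ x
ϱ^-small x 0<x with archimedean (x * ⅓) (positive⁻¹ (x * ⅓) {{pos*pos⇒pos x {{positive 0<x}} ⅓}})
  where
  ⅓ : ℚ
  ⅓ = + 1 / 3
... | d , 1≤ = d , *-cancelʳ-≤-pos (nat 3 + nat d) {{pos+nonNeg⇒pos (nat 3) (nat d) {{normalize-nonNeg d 1}}}} (begin
  ϱ^ d * (nat 3 + nat d)
    ≤⟨ bernoulli d ⟩
  nat 3 * 1ℚ
    ≤⟨ *-monoˡ (nonNegative⁻¹ (nat 3)) 1≤ ⟩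
  nat 3 * (x * (+ 1 / 3) * nat d)
    ≤⟨ ≤-add (*-nonneg (<⇒≤ 0<x) (nonNegative⁻¹ (nat 3)))
         (solve 2 (λ x n → con (nat 3) :* (x :* con (+ 1 / 3) :* n) :+ x :* con (nat 3) := x :* (con (nat 3) :+ n)) refl x (nat d)) ⟩
  x * (nat 3 + nat d) ∎)
  where open ≤-Reasoning

-- The Sylvester–Hadamard code

len : ℕ → ℕ
len zero    = 0
len (suc k) = suc (len k ℕ.+ len k)

-- The positions are the nonzero linear forms in the message bits: the new bit, the old forms, and
-- the old forms plus the new bit.
enc : ∀ k → Point k → Vec Bool (len k)
enc zero    _       = []
enc (suc k) (b ∷ x) = b ∷ (enc k x Vec.++ Vec.map (b xor_) (enc k x))

2^k≡len+1 : ∀ k → 2 ^ k ≡ len k ℕ.+ 1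
2^k≡len+1 zero = refl
2^k≡len+1 (suc k) = begin
  2 ^ k ℕ.+ (2 ^ k ℕ.+ 0)          ≡⟨ cong (2 ^ k ℕ.+_) (ℕ.+-identityʳ (2 ^ k)) ⟩
  2 ^ k ℕ.+ 2 ^ k                  ≡⟨ cong (λ m → m ℕ.+ m) (trans (2^k≡len+1 k) (ℕ.+-comm (len k) 1)) ⟩
  suc (len k ℕ.+ suc (len k))      ≡⟨ cong suc (trans (ℕ.+-suc (len k) (len k)) (ℕ.+-comm 1 _)) ⟩
  suc (len k ℕ.+ len k) ℕ.+ 1      ∎
  where open ≡-Reasoning

sgn-xor : ∀ b c → sgn (b xor c) ≡ sgn b * sgn c
sgn-xor true  true  = refl
sgn-xor true  false = refl
sgn-xor false true  = refl
sgn-xor false false = refl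

sgn² : ∀ b → sgn b * sgn b ≡ 1ℚ
sgn² true  = refl
sgn² false = refl

𝔼-even : ∀ k (g : Fun k) {f : Fun (suc k)} → (∀ b x → f (b ∷ x) ≡ g x) → 𝔼 (suc k) f ≡ 𝔼 k g
𝔼-even k g {f} p = trans (𝔼-suc k f)
  (trans (cong₂ (λ u v → ½ * (u + v)) (𝔼-cong k (p false)) (𝔼-cong k (p true))) (half-sum (𝔼 k g)))

𝔼-odd : ∀ k (g : Fun k) {f : Fun (suc k)} → (∀ b x → f (b ∷ x) ≡ sgn b * g x) → 𝔼 (suc k) f ≡ 0ℚ
𝔼-odd k g {f} p = trans (𝔼-suc k f)
  (trans (cong₂ (λ u v → ½ * (u + v))
    (trans (𝔼-cong k (p false)) (𝔼-* k 1ℚ g)) (trans (𝔼-cong k (p true)) (𝔼-* k (- 1ℚ) g)))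
    (solve 1 (λ a → con ½ :* (con 1ℚ :* a :+ con (- 1ℚ) :* a) := con 0ℚ) refl (𝔼 k g)))

col : ∀ k → Fin (len k) → Fun k
col k a x = sgn (lookup (enc k x) a)

module _ (k : ℕ) where

  colˡ : ∀ {a i} → Fin.splitAt (len k) a ≡ inj₁ i → ∀ b x → col (suc k) (suc a) (b ∷ x) ≡ col k i x
  colˡ {a} eq b x = cong sgn (trans (lookup-splitAt (len k) (enc k x) _ a)
    (cong [ lookup (enc k x) , lookup (Vec.map (b xor_) (enc k x)) ]′ eq))

  colʳ : ∀ {a i} → Fin.splitAt (len k) a ≡ inj₂ i → ∀ b x → col (suc k) (suc a) (b ∷ x) ≡ sgn b * col k i x
  colʳ {a} {i} eq b x = trans
    (cong sgn (trans (lookup-splitAt (len k) (enc k x) _ a)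
      (trans (cong [ lookup (enc k x) , lookup (Vec.map (b xor_) (enc k x)) ]′ eq)
        (lookup-map i (b xor_) (enc k x)))))
    (sgn-xor b (lookup (enc k x) i))

-- A sign or a product of two is either odd in the new bit, with mean zero, or free of it, which
-- leaves a mean for the shorter code.
enc-independent : ∀ k → PairwiseIndependent (enc k)
enc-independent zero = record { mean₁ = λ () ; mean₂ = λ { {()} } }
enc-independent (suc k) = record { mean₁ = m₁ ; mean₂ = m₂ _ _ }
  where
  open PairwiseIndependent (enc-independent k)
  m₁ : ∀ a → 𝔼 (suc k) (col (suc k) a) ≡ 0ℚ
  m₁ zero = 𝔼-odd k (λ _ → 1ℚ) (λ b x → sym (*-identityʳ (sgn b)))
  m₁ (suc a) with Fin.splitAt (len k) a in eq
  ... | inj₁ i = trans (𝔼-even k (col k i) (colˡ k eq)) (mean₁ i)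
  ... | inj₂ i = 𝔼-odd k (col k i) (colʳ k eq)

  cancel : ∀ b u v → sgn b * u * (sgn b * v) ≡ u * v
  cancel b u v = trans (solve 3 (λ s u v → s :* u :* (s :* v) := s :* s :* (u :* v)) refl (sgn b) u v)
    (trans (cong (_* (u * v)) (sgn² b)) (*-identityˡ (u * v)))

  m₂ : ∀ a c → a Fin.< c → 𝔼 (suc k) (λ x → col (suc k) a x * col (suc k) c x) ≡ 0ℚ
  m₂ zero (suc c) _ with Fin.splitAt (len k) c in eq
  ... | inj₁ j = 𝔼-odd k (col k j) (λ b x → cong (sgn b *_) (colˡ k eq b x))
  -- The new bit cancels against the form that contains it, leaving a single old form.
  ... | inj₂ j = trans (𝔼-even k (col k j) (λ b x → trans (cong (sgn b *_) (colʳ k eq b x))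
        (trans (sym (*-assoc (sgn b) (sgn b) (col k j x))) (trans (cong (_* col k j x) (sgn² b)) (*-identityˡ (col k j x))))))
      (mean₁ j)
  m₂ (suc a) (suc c) (s≤s a<c) with Fin.splitAt (len k) a in eqa | Fin.splitAt (len k) c in eqc
  ... | inj₁ i | inj₁ j = trans (𝔼-even k (λ x → col k i x * col k j x) (λ b x → cong₂ _*_ (colˡ k eqa b x) (colˡ k eqc b x)))
      -- Two positions in the same half keep their order in the shorter code.
      (mean₂ (subst₂ ℕ._<_
        (trans (cong Fin.toℕ (sym (Fin.splitAt⁻¹-↑ˡ eqa))) (Fin.toℕ-↑ˡ i (len k)))
        (trans (cong Fin.toℕ (sym (Fin.splitAt⁻¹-↑ˡ eqc))) (Fin.toℕ-↑ˡ j (len k))) a<c))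
  ... | inj₁ i | inj₂ j = 𝔼-odd k (λ x → col k i x * col k j x)
      (λ b x → trans (cong₂ _*_ (colˡ k eqa b x) (colʳ k eqc b x))
        (solve 3 (λ s u v → u :* (s :* v) := s :* (u :* v)) refl (sgn b) (col k i x) (col k j x)))
  ... | inj₂ i | inj₁ j = 𝔼-odd k (λ x → col k i x * col k j x)
      (λ b x → trans (cong₂ _*_ (colʳ k eqa b x) (colˡ k eqc b x)) (*-assoc (sgn b) (col k i x) (col k j x)))
  ... | inj₂ i | inj₂ j = trans (𝔼-even k (λ x → col k i x * col k j x)
        (λ b x → trans (cong₂ _*_ (colʳ k eqa b x) (colʳ k eqc b x)) (cancel b (col k i x) (col k j x))))
      (mean₂ (ℕ.+-cancelˡ-< (len k) _ _ (subst₂ ℕ._<_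
        (trans (cong Fin.toℕ (sym (Fin.splitAt⁻¹-↑ʳ eqa))) (Fin.toℕ-↑ʳ (len k) i))
        (trans (cong Fin.toℕ (sym (Fin.splitAt⁻¹-↑ʳ eqc))) (Fin.toℕ-↑ʳ (len k) j)) a<c)))

-- Acceptance probabilities

indicator : Bool → ℚ
indicator b = if b then 1ℚ else 0ℚ

indicator-nonneg : ∀ b → 0ℚ ≤ indicator b
indicator-nonneg true  = 0≤1
indicator-nonneg false = ≤-refl

-- `allPoints d` with its first element, the all-false point, exposed to match the type of nonempty
-- lists.
points⁺ : ∀ d → List⁺ (Point d)
points⁺ d = replicate d false List⁺.∷ List.drop 1 (allPoints d)

toList-points⁺ : ∀ d → List⁺.toList (points⁺ d) ≡ allPoints d
toList-points⁺ zero = refl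
toList-points⁺ (suc d) = helper (toList-points⁺ d)
  where
  helper : ∀ {x xs ys ps} → (x List.∷ xs) ≡ ps →
    (false ∷ x) List.∷ List.drop 1 (List.map (false ∷_) ps List.++ ys) ≡ List.map {B = Point (suc d)} (false ∷_) ps List.++ ys
  helper refl = refl

length-allPoints : ∀ d → List.length (allPoints d) ≡ 2 ^ d
length-allPoints zero = refl
length-allPoints (suc d) = trans (List.length-++ (List.map (false ∷_) (allPoints d)))
  (cong₂ ℕ._+_ (trans (List.length-map (false ∷_) (allPoints d)) (length-allPoints d))
    (trans (List.length-map (true ∷_) (allPoints d)) (trans (length-allPoints d) (sym (ℕ.+-identityʳ (2 ^ d))))))

count-sum : ∀ {t n q} (Ts : List (DTree t n q)) fs →
  nat (count Ts fs) ≡ sumℚ (List.map (λ D → indicator (run D fs)) Ts)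
count-sum List.[] fs = refl
count-sum (D List.∷ Ts) fs with run D fs
... | true  = trans (nat-suc (count Ts fs)) (cong (_+_ 1ℚ) (count-sum Ts fs))
... | false = trans (count-sum Ts fs) (sym (+-identityˡ _))

/2^ : ∀ c m .{{m≢0 : ℕ.NonZero m}} d → m ≡ 2 ^ d → (+ c) / m ≡ nat c * ½^ d
/2^ c m {{m≢0}} d eq = trans
  (/-cong {{m≢0}} {{ℕ.m*n≢0 1 (2 ^ d) {{_}} {{ℕ.m^n≢0 2 d}}}} (sym (ℤ.*-identityʳ (+ c))) (trans eq (sym (ℕ.*-identityˡ (2 ^ d)))))
  (/-* (+ c) (+ 1) 1 (2 ^ d) {{_}} {{ℕ.m^n≢0 2 d}} {{ℕ.m*n≢0 1 (2 ^ d) {{_}} {{ℕ.m^n≢0 2 d}}}})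

uniform : ∀ {t n q} d → (Point d → DTree t n q) → Test t n q
uniform d tree = List⁺.map tree (points⁺ d)

-- The list has `2 ^ d` entries, so the fraction of accepting trees is an expectation over `d`
-- random bits.
acceptProb-uniform : ∀ {t n q} d (tree : Point d → DTree t n q) fs →
  acceptProb (uniform d tree) fs ≡ 𝔼 d (λ v → indicator (run (tree v) fs))
acceptProb-uniform d tree fs = trans
  (/2^ (count (List⁺.toList (uniform d tree)) fs) _ d
    (trans (List.length-map tree (List⁺.toList (points⁺ d)))
      (trans (cong List.length (toList-points⁺ d)) (length-allPoints d))))
  (cong (_* ½^ d) (trans (count-sum (List.map tree (List⁺.toList (points⁺ d))) fs)
    (cong sumℚ (trans (sym (List.map-∘ {g = λ D → indicator (run D fs)} {f = tree} (List⁺.toList (points⁺ d))))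
      (cong (List.map (λ v → indicator (run (tree v) fs))) (toList-points⁺ d))))))

-- The test

-- A DTree t n q may stop early, so the number of points asked need only be at most q.
ask : ∀ {t n q m} → m ℕ.≤ q → (Fin m → Fin t) → (Fin m → Point n) → (Vec Bool m → Bool) → DTree t n q
ask z≤n       f x accept = leaf (accept [])
ask (s≤s m≤q) f x accept = query (f zero) (x zero) (λ b → ask m≤q (f ∘ suc) (x ∘ suc) (accept ∘ (b ∷_)))

run-ask : ∀ {t n q m} (m≤q : m ℕ.≤ q) (f : Fin m → Fin t) (x : Fin m → Point n) accept fs →
  run (ask m≤q f x accept) fs ≡ accept (Vec.tabulate (λ i → fs (f i) (x i)))
run-ask z≤n f x accept fs = refl
run-ask (s≤s m≤q) f x accept fs = run-ask m≤q (f ∘ suc) (x ∘ suc) (accept ∘ (fs (f zero) (x zero) ∷_)) fs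

some : ∀ k → (Point k → Bool) → Bool
some zero    p = p []
some (suc k) p = some k (p ∘ (false ∷_)) ∨ some k (p ∘ (true ∷_))

some-intro : ∀ k (p : Point k → Bool) x → p x ≡ true → some k p ≡ true
some-intro zero p [] eq = eq
some-intro (suc k) p (false ∷ x) eq rewrite some-intro k (p ∘ (false ∷_)) x eq = refl
some-intro (suc k) p (true ∷ x) eq rewrite some-intro k (p ∘ (true ∷_)) x eq = ∨-zeroʳ _

-- The union bound: `2^ k * 𝔼 k` sums over all points.
some-bound : ∀ k (p : Point k → Bool) → indicator (some k p) ≤ 2^ k * 𝔼 k (λ x → indicator (p x))
some-bound zero p = ≤-reflexive (sym (trans (*-identityˡ _) (𝔼-zero (λ x → indicator (p x)))))
some-bound (suc k) p = subst (indicator (some (suc k) p) ≤_) (sym (2^*𝔼-suc k (λ x → indicator (p x))))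
  (≤-trans (∨-bound (some k (p ∘ (false ∷_))) (some k (p ∘ (true ∷_))))
    (+-mono-≤ (some-bound k (p ∘ (false ∷_))) (some-bound k (p ∘ (true ∷_)))))
  where
  ∨-bound : ∀ a b → indicator (a ∨ b) ≤ indicator a + indicator b
  ∨-bound true  b = ≤-add (indicator-nonneg b) refl
  ∨-bound false b = ≤-reflexive (sym (+-identityˡ (indicator b)))

-- Splitting the random bits into blocks

take-++ : ∀ m {n} (x : Point m) (y : Point n) → Vec.take m (x Vec.++ y) ≡ x
take-++ zero [] y = refl
take-++ (suc m) (b ∷ x) y = cong (b ∷_) (take-++ m x y)

drop-++ : ∀ m {n} (x : Point m) (y : Point n) → Vec.drop m (x Vec.++ y) ≡ y
drop-++ zero [] y = refl
drop-++ (suc m) (b ∷ x) y = drop-++ m x y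

blocks : ∀ n {s} → Point (n ℕ.* s) → Vec (Point s) n
blocks zero    v = []
blocks (suc n) {s} v = Vec.take s v ∷ blocks n (Vec.drop s v)

𝔼-blocks : ∀ n {s} (F : Vec (Point s) (suc n) → ℚ) →
  𝔼 (suc n ℕ.* s) (F ∘ blocks (suc n)) ≡ 𝔼 s (λ ω → 𝔼 (n ℕ.* s) (λ v → F (ω ∷ blocks n v)))
𝔼-blocks n {s} F = trans (𝔼-++ s (n ℕ.* s) (F ∘ blocks (suc n)))
  (𝔼-cong s (λ x → 𝔼-cong (n ℕ.* s) (λ y →
    cong₂ (λ u v → F (u ∷ blocks n v)) (take-++ s x y) (drop-++ s x y))))

-- Distribution of the queried points

module _ {k t} (C : Point k → Vec Bool t) where

  width : ℕ
  width = suc (k ℕ.+ t)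

  -- A block of random bits is (y, x, r): it yields the codeword of x if y agrees with the guessed bit b,
  -- and otherwise the independent bits r.
  row : Bool → Point width → Vec Bool t
  row b (y ∷ v) = if y xor b then Vec.drop k v else C (Vec.take k v)

  sample : ∀ {n} → Bool → Vec (Point width) n → Fin t → Point n
  sample b ωs a = Vec.map (λ ω → lookup (row b ω) a) ωs

  -- The first bit of the block is uniform, so it agrees with either fixed `b` with probability one
  -- half, and `b` leaves no trace in the distribution.
  𝔼-row : ∀ b (G : Vec Bool t → ℚ) → 𝔼 width (λ ω → G (row b ω)) ≡ ½ * (𝔼 t G + 𝔼 k (λ x → G (C x)))
  𝔼-row b G = trans (𝔼-suc (k ℕ.+ t) (λ ω → G (row b ω))) (cases b)
    where
    noise : 𝔼 (k ℕ.+ t) (λ v → G (Vec.drop k v)) ≡ 𝔼 t G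
    noise = trans (𝔼-++ k t (λ v → G (Vec.drop k v)))
      (trans (𝔼-cong k (λ x → 𝔼-cong t (λ y → cong G (drop-++ k x y)))) (𝔼-const k (𝔼 t G)))
    code : 𝔼 (k ℕ.+ t) (λ v → G (C (Vec.take k v))) ≡ 𝔼 k (λ x → G (C x))
    code = trans (𝔼-++ k t (λ v → G (C (Vec.take k v))))
      (𝔼-cong k (λ x → trans (𝔼-cong t (λ y → cong (G ∘ C) (take-++ k x y))) (𝔼-const t (G (C x)))))
    cases : ∀ b → ½ * (𝔼 (k ℕ.+ t) (λ v → G (row b (false ∷ v))) + 𝔼 (k ℕ.+ t) (λ v → G (row b (true ∷ v))))
      ≡ ½ * (𝔼 t G + 𝔼 k (λ x → G (C x)))
    cases false = cong (½ *_) (trans (cong₂ _+_ code noise) (+-comm (𝔼 k (λ x → G (C x))) (𝔼 t G)))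
    cases true  = cong (½ *_) (cong₂ _+_ noise code)

  -- For a fixed guess the queried points have the distribution behind `Φ`, with one block for each
  -- coordinate.
  𝔼-sample : ∀ n b h → 𝔼 (n ℕ.* width) (λ v → ∏ (λ a → h a (sample b (blocks n v) a))) ≡ Φ C n h
  𝔼-sample zero b h = 𝔼-zero (λ v → ∏ (λ a → h a []))
  𝔼-sample (suc n) b h = begin
    𝔼 (suc n ℕ.* width) (λ v → ∏ (λ a → h a (sample b (blocks (suc n) v) a)))
      ≡⟨ 𝔼-blocks n (λ ωs → ∏ (λ a → h a (sample b ωs a))) ⟩
    𝔼 width (λ ω → 𝔼 (n ℕ.* width) (λ v → ∏ (λ a → h a (lookup (row b ω) a ∷ sample b (blocks n v) a))))
      ≡⟨ 𝔼-cong width (λ ω → 𝔼-sample n b (λ a → h a ↾ lookup (row b ω) a)) ⟩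
    𝔼 width (λ ω → Φ C n (λ a → h a ↾ lookup (row b ω) a))
      ≡⟨ 𝔼-row b (λ r → Φ C n (λ a → h a ↾ lookup r a)) ⟩
    ½ * (𝔼 t (λ r → Φ C n (λ a → h a ↾ lookup r a)) + 𝔼 k (λ x → Φ C n (slice C h x)))
      -- Restricting by independent uniform bits averages every function separately.
      ≡⟨ cong (λ u → ½ * (u + 𝔼 k (λ x → Φ C n (slice C h x)))) (sym (Φ-av C n (λ a c → h a ↾ c))) ⟩
    Φ C (suc n) h ∎
    where open ≡-Reasoning

  isCodeword : Vec Bool t → Bool
  isCodeword v = some k (λ x → does (≡-dec _≟ᵇ_ (C x) v))

  isCodeword-C : ∀ x → isCodeword (C x) ≡ true
  isCodeword-C x = some-intro k _ x (dec-true (≡-dec _≟ᵇ_ (C x) (C x)) refl)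

  -- The indicator that `fs a z` equals position `a` of the codeword, as an affine function of
  -- `sgn (fs a z)`.
  agree : ∀ {n} → (Fin t → BoolFun n) → Point k → Fin t → Fun n
  agree fs x a z = ½ + ½ * sgn (lookup (C x) a) * sgn (fs a z)

  module _ {n} (fs : Fin t → BoolFun n) where

    agree-nonneg : ∀ x a z → 0ℚ ≤ agree fs x a z
    agree-nonneg x a z with lookup (C x) a | fs a z
    ... | true  | true  = ≤ᵇ⇒≤ tt
    ... | true  | false = ≤ᵇ⇒≤ tt
    ... | false | true  = ≤ᵇ⇒≤ tt
    ... | false | false = ≤ᵇ⇒≤ tt

    agree-bounded : ∀ x a → Bounded (agree fs x a)
    agree-bounded x a z with lookup (C x) a | fs a z
    ... | true  | true  = ≤ᵇ⇒≤ tt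
    ... | true  | false = ≤ᵇ⇒≤ tt
    ... | false | true  = ≤ᵇ⇒≤ tt
    ... | false | false = ≤ᵇ⇒≤ tt

    agree-≡ : ∀ x a z → lookup (C x) a ≡ fs a z → agree fs x a z ≡ 1ℚ
    agree-≡ x a z eq rewrite eq with fs a z
    ... | true  = refl
    ... | false = refl

    -- A union bound over the codewords: for a matching word every factor `agree` is `1`, and for
    -- the others the product is nonnegative.
    codeword-bound : ∀ (z : Fin t → Point n) → indicator (isCodeword (Vec.tabulate (λ a → fs a (z a)))) ≤
      2^ k * 𝔼 k (λ x → ∏ (λ a → agree fs x a (z a)))
    codeword-bound z = ≤-trans (some-bound k _) (*-monoˡ (0≤2^ k) (𝔼-mono k pointwise))
      where
      pointwise : ∀ x → indicator (does (≡-dec _≟ᵇ_ (C x) (Vec.tabulate (λ a → fs a (z a))))) ≤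
        ∏ (λ a → agree fs x a (z a))
      pointwise x with ≡-dec _≟ᵇ_ (C x) (Vec.tabulate (λ a → fs a (z a)))
      ... | yes eq = ≤-reflexive (sym (∏-one _ (λ a → agree-≡ x a (z a)
                       (trans (cong (λ v → lookup v a) eq) (lookup∘tabulate _ a)))))
      ... | no _ = ∏-nonneg _ (λ a → agree-nonneg x a (z a))

-- The query trees, completeness and a bound on acceptance

module _ {k t q} (C : Point k → Vec Bool (suc t)) (t<q : suc t ℕ.≤ q) where

  tree : ∀ {n} → Vec (Point (width C)) n → DTree (suc t) n (suc q)
  tree ωs = query zero (Vec.map Vec.head ωs) (λ b → ask t<q (λ a → a) (sample C b ωs) (isCodeword C))

  run-tree : ∀ {n} (ωs : Vec (Point (width C)) n) fs → run (tree ωs) fs ≡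
    isCodeword C (Vec.tabulate (λ a → fs a (sample C (fs zero (Vec.map Vec.head ωs)) ωs a)))
  run-tree ωs fs = run-ask t<q (λ a → a) (sample C (fs zero (Vec.map Vec.head ωs)) ωs) (isCodeword C) fs

  test : ∀ n → Test (suc t) n (suc q)
  test n = uniform (n ℕ.* width C) (tree ∘ blocks n)

  complete : ∀ n (i : Fin n) → 1ℚ ≤ acceptProb (test n) (λ _ → dictator i)
  complete n i = ≤-reflexive (sym (trans (acceptProb-uniform (n ℕ.* width C) (tree ∘ blocks n) (λ _ → dictator i))
    (trans (𝔼-cong (n ℕ.* width C) (λ v → cong indicator (accepts (blocks n v)))) (𝔼-const (n ℕ.* width C) 1ℚ))))
    where
    -- The guess is the first bit of this very block, so `row` takes the codeword branch.
    row-head : ∀ (ω : Point (width C)) → row C (Vec.head ω) ω ≡ C (Vec.take k (Vec.tail ω))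
    row-head (y ∷ v) rewrite xor-same y = refl
    -- The answers of the dictator are the entries at coordinate `i`, which together form one row.
    accepts : ∀ ωs → run (tree ωs) (λ _ → dictator i) ≡ true
    accepts ωs = trans (run-tree ωs (λ _ → dictator i)) (trans
      (cong (isCodeword C) (trans
        (tabulate-cong (λ a → trans (lookup-map i (λ ω → lookup (row C (lookup (Vec.map Vec.head ωs) i) ω) a) ωs)
          (cong (λ r → lookup r a) (trans (cong (λ b → row C b ω) (lookup-map i Vec.head ωs)) (row-head ω)))))
        (tabulate∘lookup (C (Vec.take k (Vec.tail ω))))))
      (isCodeword-C C (Vec.take k (Vec.tail ω))))
      where
      ω : Point (width C)
      ω = lookup ωs i

  -- The sum over both guesses b of the answer to the first query drops the condition that b is that
  -- answer: this makes the later query points independent of the functions, at the cost of a factor 2.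
  acceptProb≤ : ∀ n fs → acceptProb (test n) fs ≤ 2ℚ * (2^ k * 𝔼 k (λ x → Φ C n (agree C fs x)))
  acceptProb≤ n fs = begin
    acceptProb (test n) fs
      ≡⟨ acceptProb-uniform d (tree ∘ blocks n) fs ⟩
    𝔼 d (λ v → indicator (run (tree (blocks n v)) fs))
      ≤⟨ 𝔼-mono d (λ v → ≤-trans
           (≤-reflexive (cong indicator (run-tree (blocks n v) fs)))
           (≤-trans (codeword-bound C fs (sample C (fs zero (Vec.map Vec.head (blocks n v))) (blocks n v)))
             (guess (fs zero (Vec.map Vec.head (blocks n v))) (λ b → U b v) (0≤U v)))) ⟩
    𝔼 d (λ v → U false v + U true v)
      ≡⟨ 𝔼-+ d (U false) (U true) ⟩
    𝔼 d (U false) + 𝔼 d (U true)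
      ≡⟨ cong₂ _+_ (𝔼-U false) (𝔼-U true) ⟩
    A + A
      ≡⟨ solve 1 (λ a → a :+ a := con 2ℚ :* a) refl A ⟩
    2ℚ * A ∎
    where
    open ≤-Reasoning
    d : ℕ
    d = n ℕ.* width C
    A : ℚ
    A = 2^ k * 𝔼 k (λ x → Φ C n (agree C fs x))
    P : Bool → Point d → Point k → ℚ
    P b v x = ∏ (λ a → agree C fs x a (sample C b (blocks n v) a))
    U : Bool → Point d → ℚ
    U b v = 2^ k * 𝔼 k (P b v)
    0≤U : ∀ v b → 0ℚ ≤ U b v
    0≤U v b = *-nonneg (0≤2^ k) (subst (_≤ 𝔼 k (P b v)) (𝔼-const k 0ℚ)
      (𝔼-mono k (λ x → ∏-nonneg _ (λ a → agree-nonneg C fs x a (sample C b (blocks n v) a)))))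
    guess : ∀ b (u : Bool → ℚ) → (∀ b → 0ℚ ≤ u b) → u b ≤ u false + u true
    guess false u p = ≤-add (p true) refl
    guess true  u p = ≤-add (p false) (+-comm (u true) (u false))
    𝔼-U : ∀ b → 𝔼 d (U b) ≡ A
    𝔼-U b = trans (𝔼-* d (2^ k) (λ v → 𝔼 k (P b v))) (cong (2^ k *_)
      (trans (𝔼-swap d k (P b)) (𝔼-cong k (λ x → 𝔼-sample C n b (agree C fs x)))))

-- Soundness

infl-nonneg : ∀ n j h → 0ℚ ≤ infl n j h
infl-nonneg (suc n) zero h = stab-nonneg (nonNegative⁻¹ ϱ) n (df h)
infl-nonneg (suc n) (suc j) h = infl-nonneg n j (av h)

module _ {k t} (C : Point k → Vec Bool t) where

  NoShare-infl : ∀ {θ} n h → (∀ {a b} j → a Fin.< b → infl n j (h a) ≤ θ ⊎ infl n j (h b) ≤ θ) → NoShare C θ n h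
  NoShare-infl zero h p = tt
  NoShare-infl (suc n) h p = p zero , NoShare-infl n (λ a → av (h a)) (λ j → p (suc j))

  infl-agree : ∀ {n} (fs : Fin t → BoolFun n) x a j → infl n j (agree C fs x a) ≤ infl n j (sgn ∘ fs a)
  infl-agree {n} fs x a j = begin
    infl n j (agree C fs x a)
      ≡⟨ infl-affine n j ½ (½ * s) (sgn ∘ fs a) (agree C fs x a) (λ _ → refl) ⟩
    (½ * s) * (½ * s) * I
      ≡⟨ trans (solve 2 (λ s i → (con ½ :* s) :* (con ½ :* s) :* i := con (½ * ½) :* (s :* s) :* i) refl s I)
           (cong (λ u → ½ * ½ * u * I) (sgn² (lookup (C x) a))) ⟩
    ½ * ½ * 1ℚ * I
      ≤⟨ *-monoʳ-≤-nonNeg I {{nonNegative (infl-nonneg n j (sgn ∘ fs a))}} ½*½≤1 ⟩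
    1ℚ * I
      ≡⟨ *-identityˡ I ⟩
    I ∎
    where
    open ≤-Reasoning
    s I : ℚ
    s = sgn (lookup (C x) a)
    I = infl n j (sgn ∘ fs a)
    ½*½≤1 : ½ * ½ * 1ℚ ≤ 1ℚ
    ½*½≤1 = ≤ᵇ⇒≤ tt

𝔼-flip : ∀ n (f : Fun n) → 𝔼 n (f ∘ flipAll) ≡ 𝔼 n f
𝔼-flip zero f = refl
𝔼-flip (suc n) f = begin
  𝔼 (suc n) (f ∘ flipAll)
    ≡⟨ 𝔼-suc n (f ∘ flipAll) ⟩
  ½ * (𝔼 n ((f ↾ true) ∘ flipAll) + 𝔼 n ((f ↾ false) ∘ flipAll))
    ≡⟨ cong₂ (λ a b → ½ * (a + b)) (𝔼-flip n (f ↾ true)) (𝔼-flip n (f ↾ false)) ⟩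
  ½ * (𝔼 n (f ↾ true) + 𝔼 n (f ↾ false))
    ≡⟨ cong (½ *_) (+-comm (𝔼 n (f ↾ true)) (𝔼 n (f ↾ false))) ⟩
  ½ * (𝔼 n (f ↾ false) + 𝔼 n (f ↾ true))
    ≡⟨ sym (𝔼-suc n f) ⟩
  𝔼 (suc n) f ∎
  where open ≡-Reasoning

-- Flipping all bits preserves the uniform distribution and negates the sign, so the mean is its own
-- negative.
𝔼-folded : ∀ n (f : BoolFun n) → Folded f → 𝔼 n (sgn ∘ f) ≡ 0ℚ
𝔼-folded n f fold = begin
  e                  ≡⟨ solve 1 (λ e → e := con ½ :* (e :+ e)) refl e ⟩
  ½ * (e + e)        ≡⟨ cong (λ u → ½ * (e + u)) antisymmetric ⟩
  ½ * (e + - 1ℚ * e) ≡⟨ solve 1 (λ e → con ½ :* (e :+ con (- 1ℚ) :* e) := con 0ℚ) refl e ⟩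
  0ℚ                 ∎
  where
  open ≡-Reasoning
  e : ℚ
  e = 𝔼 n (sgn ∘ f)
  antisymmetric : e ≡ - 1ℚ * e
  antisymmetric = trans (sym (𝔼-flip n (sgn ∘ f)))
    (trans (𝔼-cong n (λ x → trans (cong sgn (fold x)) (trans (sgn-not (f x))
      (solve 1 (λ a → :- a := con (- 1ℚ) :* a) refl (sgn (f x))))))
      (𝔼-* n (- 1ℚ) (sgn ∘ f)))

𝔼-agree : ∀ {k t n} (C : Point k → Vec Bool t) (fs : Fin t → BoolFun n) x a → Folded (fs a) →
  𝔼 n (agree C fs x a) ≡ ½
𝔼-agree {n = n} C fs x a fold = begin
  𝔼 n (λ z → ½ + ½ * s * sgn (fs a z))
    ≡⟨ 𝔼-+ n (λ _ → ½) (λ z → ½ * s * sgn (fs a z)) ⟩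
  𝔼 n (λ _ → ½) + 𝔼 n (λ z → ½ * s * sgn (fs a z))
    ≡⟨ cong₂ _+_ (𝔼-const n ½) (trans (𝔼-* n (½ * s) (sgn ∘ fs a)) (cong (½ * s *_) (𝔼-folded n (fs a) fold))) ⟩
  ½ + ½ * s * 0ℚ
    ≡⟨ solve 1 (λ s → con ½ :+ con ½ :* s :* con 0ℚ := con ½) refl s ⟩
  ½ ∎
  where
  open ≡-Reasoning
  s : ℚ
  s = sgn (lookup (C x) a)

-- Numerical form of the soundness threshold

nat-* : ∀ m n → nat (m ℕ.* n) ≡ nat m * nat n
nat-* m n = trans (cong (_/ 1) (ℤ.pos-* m n)) (/-* (+ m) (+ n) 1 1)

nat-2^ : ∀ k → nat (2 ^ k) ≡ 2^ k
nat-2^ zero = refl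
nat-2^ (suc k) = trans (nat-* 2 (2 ^ k)) (cong (2ℚ *_) (nat-2^ k))

½^≡∏ : ∀ t → ½^ t ≡ ∏ {t} (λ _ → ½)
½^≡∏ zero = refl
½^≡∏ (suc t) = trans (½^-suc t) (cong (½ *_) (½^≡∏ t))

1≤2^ : ∀ k → 1ℚ ≤ 2^ k
1≤2^ zero = ≤-refl
1≤2^ (suc k) = *-mono 0≤1 (0≤2^ k) 1≤2 (1≤2^ k)
  where
  1≤2 : 1ℚ ≤ 2ℚ
  1≤2 = ≤ᵇ⇒≤ tt

threshold : ℕ → ℚ
threshold t = ((+ ((t ℕ.+ 1) ^ 2)) / (2 ^ t)) {{ℕ.m^n≢0 2 t}}

-- The guessed bit loses a factor `2` and the union over codewords `2^ (suc k)`, which is `t + 1`;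
-- as `2 ≤ 2^ (suc k)`, the product is at most `(t + 1)²`.
threshold≥ : ∀ k t → 2 ^ suc k ≡ t ℕ.+ 1 → 2ℚ * (2^ (suc k) * ∏ {t} (λ _ → ½)) ≤ threshold t
threshold≥ k t eq = begin
  2ℚ * (K * H)
    ≤⟨ ≤-add (*-nonneg (*-nonneg 0≤K (∏-nonneg {t} (λ _ → ½) (λ _ → 0≤½))) (*-nonneg 0≤2 (p-1≥0 (1≤2^ k))))
         (solve 2 (λ m h → con 2ℚ :* (con 2ℚ :* m :* h) :+ con 2ℚ :* m :* h :* (con 2ℚ :* (m :- con 1ℚ)) :=
                           con 2ℚ :* m :* (con 2ℚ :* m) :* h) refl (2^ k) H) ⟩
  K * K * H
    ≡⟨ cong₂ _*_ (sym square) (sym (½^≡∏ t)) ⟩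
  nat ((t ℕ.+ 1) ^ 2) * ½^ t
    ≡⟨ sym (/2^ ((t ℕ.+ 1) ^ 2) (2 ^ t) {{ℕ.m^n≢0 2 t}} t refl) ⟩
  threshold t ∎
  where
  open ≤-Reasoning
  K H : ℚ
  K = 2^ (suc k)
  H = ∏ {t} (λ _ → ½)
  0≤K : 0ℚ ≤ K
  0≤K = 0≤2^ (suc k)
  p-1≥0 : ∀ {p} → 1ℚ ≤ p → 0ℚ ≤ p - 1ℚ
  p-1≥0 {p} 1≤p = subst (_≤ p - 1ℚ) (+-inverseʳ 1ℚ) (+-monoˡ-≤ (- 1ℚ) 1≤p)
  K≡ : nat (t ℕ.+ 1) ≡ K
  K≡ = trans (cong nat (sym eq)) (nat-2^ (suc k))
  square : nat ((t ℕ.+ 1) ^ 2) ≡ K * K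
  square = trans (nat-* (t ℕ.+ 1) ((t ℕ.+ 1) ℕ.* 1))
    (cong₂ _*_ K≡ (trans (cong nat (ℕ.*-identityʳ (t ℕ.+ 1))) K≡))

-- Choice of the soundness constants

module _ {k t q} (C : Point k → Vec Bool (suc t)) (t<q : suc t ℕ.≤ q) (PI : PairwiseIndependent C) where

  -- The sum of ones bounds the total noise stability, one unit for each function.
  errorConst : ℚ
  errorConst = 2ℚ * (2^ k * (2^ (suc t) * sum {suc t} (λ _ → 1ℚ)))

  errorConst-nonneg : 0ℚ ≤ errorConst
  errorConst-nonneg = *-nonneg 0≤2 (*-nonneg (0≤2^ k)
    (*-nonneg (0≤2^ (suc t)) (sum-nonneg {suc t} {λ _ → 1ℚ} (λ _ → 0≤1))))

  acceptProb-bound : ∀ {Λ δ} → 0ℚ ≤ δ → 0ℚ ≤ Λ → Λ * δ ≡ 1ℚ → ∀ n fs → (∀ a → Folded (fs a)) →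
    (∀ {a b} j → a Fin.< b → infl n j (sgn ∘ fs a) ≤ δ * δ ⊎ infl n j (sgn ∘ fs b) ≤ δ * δ) →
    acceptProb (test C t<q n) fs ≤ 2ℚ * (2^ k * ∏ {suc t} (λ _ → ½)) + errorConst * δ
  acceptProb-bound {Λ} {δ} 0≤δ 0≤Λ Λδ≡1 n fs folded p = begin
    acceptProb (test C t<q n) fs
      ≤⟨ acceptProb≤ C t<q n fs ⟩
    2ℚ * (2^ k * 𝔼 k (λ x → Φ C n (agree C fs x)))
      ≤⟨ *-monoˡ 0≤2 (*-monoˡ (0≤2^ k) (subst (𝔼 k (λ x → Φ C n (agree C fs x)) ≤_) (𝔼-const k (H + e))
           (𝔼-mono k close))) ⟩
    2ℚ * (2^ k * (H + e))
      ≡⟨ solve 5 (λ k h m d s → con 2ℚ :* (k :* (h :+ m :* d :* s)) :=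
                                con 2ℚ :* (k :* h) :+ con 2ℚ :* (k :* (m :* s)) :* d) refl (2^ k) H (2^ (suc t)) δ S ⟩
    2ℚ * (2^ k * H) + errorConst * δ ∎
    where
    open ≤-Reasoning
    H S e : ℚ
    H = ∏ {suc t} (λ _ → ½)
    S = sum {suc t} (λ _ → 1ℚ)
    e = 2^ (suc t) * δ * S
    close : ∀ x → Φ C n (agree C fs x) ≤ H + e
    close x = begin
      X
        ≡⟨ solve 2 (λ x h → x := h :+ (x :- h)) refl X H ⟩
      H + (X - H)
        ≤⟨ +-monoʳ-≤ H (p≤∣p∣ (X - H)) ⟩
      H + ∣ X - H ∣
        -- By folding every factor has mean `½`, so `H` is the product of the means.
        ≡⟨ cong (λ u → H + ∣ X - u ∣) (∏-cong (λ a → sym (𝔼-agree C fs x a (folded a)))) ⟩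
      H + ∣ X - ∏ (λ a → 𝔼 n (agree C fs x a)) ∣
        ≤⟨ +-monoʳ-≤ H (Φ≈∏𝔼 C PI 0≤δ 0≤Λ Λδ≡1 n (agree C fs x) (agree-bounded C fs x)
             (NoShare-infl C n (agree C fs x) (λ {a} {b} j a<b → Sum.map
               (≤-trans (infl-agree C fs x a j)) (≤-trans (infl-agree C fs x b j)) (p j a<b)))) ⟩
      H + 2^ (suc t) * δ * sum (λ a → stab ϱ n (agree C fs x a))
        ≤⟨ +-monoʳ-≤ H (*-monoˡ (*-nonneg (0≤2^ (suc t)) 0≤δ)
             (sum-mono (λ a → stab≤1 (nonNegative⁻¹ ϱ) ϱ≤1 n (agree C fs x a) (agree-bounded C fs x a)))) ⟩
      H + e ∎
      where
      X : ℚ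
      X = Φ C n (agree C fs x)

  pair-of-influences : ∀ {s ε Λ δ τ} w → 2ℚ * (2^ k * ∏ {suc t} (λ _ → ½)) ≤ s →
    0ℚ ≤ Λ → 0ℚ < δ → Λ * δ ≡ 1ℚ → errorConst * δ + δ ≡ ε → τ + τ ≡ δ * δ → ϱ^ (suc w) ≤ τ →
    ∀ n (fs : Fin (suc t) → BoolFun n) → (∀ a → Folded (fs a)) → s + ε ≤ acceptProb (test C t<q n) fs →
    Σ (Fin (suc t)) λ a → Σ (Fin (suc t)) λ b → Σ (Fin n) λ i →
      a ≢ b × τ ≤ lowInfluence (suc w) i (fs a) × τ ≤ lowInfluence (suc w) i (fs b)
  pair-of-influences {s} {ε} {Λ} {δ} {τ} w s≥ 0≤Λ 0<δ Λδ≡1 ε≡ 2τ≡ ϱ^≤τ n fs folded accepted =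
    -- The search is finite and the comparisons are decidable, so arguing by contradiction is
    -- constructive.
    decidable-stable
      (Fin.any? (λ a → Fin.any? (λ b → Fin.any? (λ i → ¬? (a Fin.≟ b) ×-dec
        (τ ≤? lowInfluence (suc w) i (fs a) ×-dec τ ≤? lowInfluence (suc w) i (fs b))))))
      (λ unshared → <-irrefl refl (contra (λ a b j τ≤ τ≤′ a<b → unshared (a , b , j , Fin.<⇒≢ a<b , τ≤ , τ≤′))))
    where
    open ≤-Reasoning
    small : ∀ (f : BoolFun n) j → ¬ τ ≤ lowInfluence (suc w) j f → infl n j (sgn ∘ f) ≤ δ * δ
    small f j τ≰ = begin
      infl n j (sgn ∘ f)
        ≤⟨ infl≤influence w n j (sgn ∘ f) ⟩
      lowInfluence (suc w) j f + ϱ^ (suc w) * stab 1ℚ n (sgn ∘ f)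
        -- Low degrees and the damped tail contribute at most `τ` each, the latter because a sign
        -- function has total Fourier weight at most `1`.
        ≤⟨ +-mono-≤ (<⇒≤ (≰⇒> τ≰)) (*-mono (0≤ϱ^ (suc w)) 0≤1 ϱ^≤τ
             (stab≤1 0≤1 ≤-refl n (sgn ∘ f) (λ x → ≤-reflexive (∣sgn∣ (f x))))) ⟩
      τ + τ * 1ℚ
        ≡⟨ cong (_+_ τ) (*-identityʳ τ) ⟩
      τ + τ
        ≡⟨ 2τ≡ ⟩
      δ * δ ∎
    contra : (∀ a b j → τ ≤ lowInfluence (suc w) j (fs a) → τ ≤ lowInfluence (suc w) j (fs b) → ¬ a Fin.< b) →
      s + ε < s + ε
    contra unshared = begin-strict
      s + ε
        ≤⟨ accepted ⟩
      acceptProb (test C t<q n) fs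
        ≤⟨ acceptProb-bound (<⇒≤ 0<δ) 0≤Λ Λδ≡1 n fs folded noShare ⟩
      2ℚ * (2^ k * ∏ {suc t} (λ _ → ½)) + errorConst * δ
        ≤⟨ +-monoˡ-≤ (errorConst * δ) s≥ ⟩
      s + errorConst * δ
        -- The extra `δ` in `ε≡` makes the inequality strict.
        <⟨ +-monoʳ-< s (subst (_< errorConst * δ + δ) (+-identityʳ (errorConst * δ)) (+-monoʳ-< (errorConst * δ) 0<δ)) ⟩
      s + (errorConst * δ + δ)
        ≡⟨ cong (_+_ s) ε≡ ⟩
      s + ε ∎
      where
      noShare : ∀ {a b} j → a Fin.< b → infl n j (sgn ∘ fs a) ≤ δ * δ ⊎ infl n j (sgn ∘ fs b) ≤ δ * δ
      noShare {a} {b} j a<b = split-on (τ ≤? lowInfluence (suc w) j (fs a))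
        where
        split-on : Dec (τ ≤ lowInfluence (suc w) j (fs a)) → infl n j (sgn ∘ fs a) ≤ δ * δ ⊎ infl n j (sgn ∘ fs b) ≤ δ * δ
        split-on (no τ≰)  = inj₁ (small (fs a) j τ≰)
        split-on (yes τ≤) = inj₂ (small (fs b) j (λ τ≤′ → unshared a b j τ≤ τ≤′ a<b))

  -- `ε` determines `δ`, then `δ` determines `τ`, and `τ` determines `w`, all before `n` and the
  -- functions are given.
  sound : ∀ {s} → 2ℚ * (2^ k * ∏ {suc t} (λ _ → ½)) ≤ s → (ε : ℚ) → 0ℚ < ε →
    Σ ℚ λ τ → 0ℚ < τ × Σ ℕ λ w → 0 ℕ.< w ×
      ((n : ℕ) (fs : Fin (suc t) → BoolFun n) → (∀ a → Folded (fs a)) →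
        s + ε ≤ acceptProb (test C t<q n) fs →
        Σ (Fin (suc t)) λ a → Σ (Fin (suc t)) λ b → Σ (Fin n) λ i →
          a ≢ b × τ ≤ lowInfluence w i (fs a) × τ ≤ lowInfluence w i (fs b))
  sound s≥ ε 0<ε =
    let w , ϱ^≤τ = ϱ^-small τ (positive⁻¹ τ) in
    τ , positive⁻¹ τ , suc w , s≤s z≤n ,
    pair-of-influences w s≥ (<⇒≤ (positive⁻¹ (1/ δ) {{1/pos⇒pos δ}})) (positive⁻¹ δ) (*-inverseˡ δ) ε≡
      (solve 1 (λ d → con ½ :* d :+ con ½ :* d := d) refl (δ * δ))
      (≤-trans (*-mono (nonNegative⁻¹ ϱ) (0≤ϱ^ w) ϱ≤1 ≤-refl) (subst (_≤ τ) (sym (*-identityˡ (ϱ^ w))) ϱ^≤τ))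
    where
    instance
      1+E-pos : Positive (1ℚ + errorConst)
      1+E-pos = pos+nonNeg⇒pos 1ℚ errorConst {{nonNegative errorConst-nonneg}}
      1+E-nonZero : NonZero (1ℚ + errorConst)
      1+E-nonZero = pos⇒nonZero (1ℚ + errorConst)
      ε-pos : Positive ε
      ε-pos = positive 0<ε
    -- `δ` is `ε / (1 + errorConst)`, the solution of `errorConst * δ + δ ≡ ε`.
    r δ : ℚ
    r = 1/ (1ℚ + errorConst)
    δ = ε * r
    instance
      r-pos : Positive r
      r-pos = 1/pos⇒pos (1ℚ + errorConst)
      δ-pos : Positive δ
      δ-pos = pos*pos⇒pos ε r
      δ-nonZero : NonZero δ
      δ-nonZero = pos⇒nonZero δ
      δδ-pos : Positive (δ * δ)
      δδ-pos = pos*pos⇒pos δ δ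
    -- Half of the level `δ * δ`; the other half is reserved for the tail of high degrees.
    τ : ℚ
    τ = ½ * (δ * δ)
    instance
      τ-pos : Positive τ
      τ-pos = pos*pos⇒pos ½ (δ * δ)
    ε≡ : errorConst * δ + δ ≡ ε
    ε≡ = trans (solve 3 (λ c e r → c :* (e :* r) :+ e :* r := e :* ((con 1ℚ :+ c) :* r)) refl errorConst ε r)
      (trans (cong (ε *_) (*-inverseʳ (1ℚ + errorConst))) (*-identityʳ ε))

-- Makes the lengths `len k` unbounded, so that infinitely many `t` occur.
n≤len : ∀ n → n ℕ.≤ len n
n≤len zero = z≤n
n≤len (suc n) = s≤s (ℕ.≤-trans (n≤len n) (ℕ.m≤m+n (len n) (len n)))

mainTheorem1 : (N : ℕ) → Σ ℕ λ t → Σ ℕ λ k →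
    N ℕ.≤ t × 0 ℕ.< t × 2 ^ k ≡ t ℕ.+ 1 ×
    Σ ((n : ℕ) → Test t n (t ℕ.+ k)) λ T →
    ((n : ℕ) (i : Fin n) → 1ℚ ≤ acceptProb (T n) (λ _ → dictator i))
    ×
    ((ε : ℚ) → 0ℚ < ε →
    Σ ℚ λ τ → 0ℚ < τ × Σ ℕ λ w → 0 ℕ.< w ×
    ((n : ℕ) (fs : Fin t → BoolFun n) → (∀ a → Folded (fs a)) →
    ((+ ((t ℕ.+ 1) ^ 2)) / (2 ^ t)) {{m^n≢0 2 t}} + ε ≤ acceptProb (T n) fs →
    Σ (Fin t) λ a → Σ (Fin t) λ b → Σ (Fin n) λ i →
    a ≢ b × τ ≤ lowInfluence w i (fs a) × τ ≤ lowInfluence w i (fs b)))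
-- With `k = M + 1` the length is positive and `t + 1 = 2 ^ k` is at least `2`, as `threshold≥`
-- requires.
mainTheorem1 M = len k , k , ℕ.≤-trans (ℕ.n≤1+n M) (n≤len k) , s≤s z≤n , 2^k≡len+1 k ,
    test C t<q , complete C t<q , sound C t<q (enc-independent k) (threshold≥ M (len k) (2^k≡len+1 k))
  where
  k m : ℕ
  k = suc M
  m = len M ℕ.+ len M
  C : Point k → Vec Bool (suc m)
  C = enc k
  -- The tree makes `t + 1` queries, which fit into `t + k` because `k` is positive.
  t<q : suc m ℕ.≤ m ℕ.+ suc M
  t<q = subst (suc m ℕ.≤_) (sym (ℕ.+-suc m M)) (s≤s (ℕ.m≤m+n m M))
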